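{- Let $\mathscr{A}$ be a nonempty abelian arrangement and $H\in\mathscr{A}$. Then $\chi_{\mathscr{A}}(t)=\chi_{\mathscr{A}'}(t)-\chi_{\mathscr{A}''}(t)$, where $\mathscr{A}'$ and $\mathscr{A}''$ are the deletion and restriction with respect to $H$.
   Context: Let $G\cong(\mathbb{S}^1)^a\times\mathbb{R}^b$ ($a,b\ge0$) be a connected abelian Lie group, $g=a+b$, $\Gamma\cong\mathbb{Z}^\ell$, and $T=\operatorname{Hom}(\Gamma,G)\cong G^\ell$. For $\alpha\in\Gamma\setminus\{0\}$ and $c\in G$, $H_{\alpha,c}=\{\varphi\in T:\varphi(\alpha)=c\}$. For a finite set $\mathcal{A}\subseteq(\Gamma\setminus\{0\})\times G$, the abelian arrangement $\mathscr{A}$ is the set of connected components of the $H_{\alpha,c}$, $(\alpha,c)\in\mathcal{A}$. Its poset of layers $L(\mathscr{A})$ is the set of connected components of nonempty intersections of subsets of $\mathscr{A}$ (the empty intersection being $T$), ordered by reverse inclusion, with rank $\operatorname{rk}(X)=\operatorname{codim}(X)/g$; $\mu$ is its Möbius function. The characteristic polynomial is $\chi_{\mathscr{A}}(t)=\sum_{X\in L(\mathscr{A})}\mu(T,X)t^{\dim_{\mathbb{R}}X}$. Deletion: $\mathscr{A}'=\mathscr{A}\setminus\{H\}$, an arrangement in $T$. Restriction: $\mathscr{A}''$ is the set of connected components of nonempty $K\cap H$, $K\in\mathscr{A}\setminus\{H\}$, an arrangement in $H\cong G^{\ell-1}$ (its layers are computed inside $H$, with $H$ as minimal element).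
   Formalization: The case a = b = 0 (G trivial, g = 0) is excluded; there T is a point, H = T, all three characteristic polynomials equal 1, and the identity would read 1 = 1 − 1, so the claim fails; the rank codim/g is also undefined there. -}

module Defs where

open import Algebra.Bundles using (AbelianGroup; CommutativeRing)
open import Algebra.Morphism.Bundles using (GroupHomomorphism)
open import Algebra.Morphism.Structures
  using (IsGroupHomomorphism; IsGroupIsomorphism)
import Algebra.Construct.DirectProduct as DirectProduct
import Algebra.Construct.Pointwise as Pointwise
import Algebra.Properties.AbelianGroup as AbelianGroupProperties
import Algebra.Properties.Group as GroupProperties
import Algebra.Properties.Monoid.Mult as MonoidMult
import Algebra.Properties.CommutativeSemigroup as CommutativeSemigroupProperties
open import Axiom.ExcludedMiddle using (ExcludedMiddle)
open import Data.Fin.Base using (Fin)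
open import Data.Fin.Induction using (po-wellFounded)
import Data.Fin.Properties as Fin
open import Data.Integer.Base as ℤ using (ℤ; 0ℤ; 1ℤ)
import Data.Integer.Properties as ℤ
open import Data.List.Base using (List; []; _++_)
open import Data.List.Relation.Unary.All as All using (All; [])
import Data.List.Relation.Unary.All.Properties as All
open import Data.List.Relation.Unary.Any using (Any)
open import Data.Nat.Base as ℕ using (ℕ; zero; suc)
import Data.Nat.Properties as ℕ
open import Data.Product using (Σ; ∃; ∃₂; _×_; _,_; proj₁; proj₂)
open import Data.Sum.Base using (_⊎_; inj₁; inj₂)
open import Data.Unit.Base using (⊤; tt)
open import Function.Base using (_∘_)
open import Function.Bundles using (Func; Inverse)
open import Induction.WellFounded using (module All)
open import Level using (Level; 0ℓ; _⊔_) renaming (suc to lsuc)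
open import Relation.Binary.Bundles using (Setoid)
open import Relation.Binary.Core using (Rel)
import Relation.Binary.Construct.NonStrictToStrict as ToStrict
import Relation.Binary.Construct.On as On
import Relation.Binary.Reasoning.Setoid as ≈-Reasoning
open import Relation.Binary.Definitions using (Decidable; _Respects_)
open import Relation.Binary.PropositionalEquality
  using (_≡_; refl; cong; cong₂; isEquivalence)
open import Relation.Binary.Structures
  using (IsPartialOrder; IsTotalOrder)
open import Relation.Nullary using (¬_; yes; no)
open import Relation.Nullary.Negation using (contradiction)
open import Relation.Unary
  using (Pred; _∈_; _⊆_; _≐_; _≬_; _∩_; _∪_; ⋃; U; Satisfiable)

1ℓ : Level
1ℓ = lsuc 0ℓ

-- The axioms of a Dedekind-complete ordered field, which determine ℝ up to
-- unique isomorphism.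
record Reals : Set₁ where
  infix 4 _≤_
  field
    commutativeRing : CommutativeRing 0ℓ 0ℓ

  open CommutativeRing commutativeRing public

  field
    _≤_          : Rel Carrier 0ℓ
    isTotalOrder : IsTotalOrder _≈_ _≤_
    +-monoʳ-≤    : ∀ x {y z} → y ≤ z → x + y ≤ x + z
    *-nonNeg     : ∀ {x y} → 0# ≤ x → 0# ≤ y → 0# ≤ x * y
    0≤1          : 0# ≤ 1#
    0≉1          : ¬ 0# ≈ 1#
    inverse      : ∀ x → ¬ x ≈ 0# → ∃ λ y → x * y ≈ 1#

  UpperBound : Pred Carrier 0ℓ → Pred Carrier 0ℓ
  UpperBound P u = ∀ {x} → P x → x ≤ u

  field
    supremum : (P : Pred Carrier 0ℓ) →
               Satisfiable P → Satisfiable (UpperBound P) →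
               ∃ λ s → UpperBound P s × (∀ {u} → UpperBound P u → s ≤ u)

  open IsTotalOrder isTotalOrder public
    using (total; antisym; ≤-respˡ-≈; ≤-respʳ-≈)
    renaming (refl to ≤-refl; trans to ≤-trans; reflexive to ≤-reflexive)

  open ToStrict _≈_ _≤_ public using (_<_)

  <-respˡ-≈ : ∀ {x y z} → y ≈ z → y < x → z < x
  <-respˡ-≈ = ToStrict.<-respˡ-≈ _≈_ _≤_ trans ≤-respˡ-≈

  <-respʳ-≈ : ∀ {x y z} → y ≈ z → x < y → x < z
  <-respʳ-≈ = ToStrict.<-respʳ-≈ _≈_ _≤_ sym trans ≤-respʳ-≈

  ≤-<-trans : ∀ {x y z} → x ≤ y → y < z → x < z
  ≤-<-trans = ToStrict.≤-<-trans _≈_ _≤_ ≤-trans antisym ≤-respˡ-≈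

  <-≤-trans : ∀ {x y z} → x < y → y ≤ z → x < z
  <-≤-trans = ToStrict.<-≤-trans _≈_ _≤_ sym ≤-trans antisym ≤-respʳ-≈

  x<x+1 : ∀ x → x < x + 1#
  x<x+1 x = ≤-respˡ-≈ (+-identityʳ x) (+-monoʳ-≤ x 0≤1)
          , λ x≈x+1 → 0≉1 (GroupProperties.∙-cancelˡ +-group x 0# 1#
                             (trans (+-identityʳ x) x≈x+1))

  x-1<x : ∀ x → x - 1# < x
  x-1<x x = <-respʳ-≈ (trans (+-assoc x (- 1#) 1#)
                      (trans (+-congˡ (-‿inverseˡ 1#)) (+-identityʳ x)))
                      (x<x+1 (x - 1#))

-- Subsets of a setoid are predicates; the open ones are required to be
-- closed under the setoid equality.
record Topology (S : Setoid 0ℓ 0ℓ) (o : Level) : Set (1ℓ ⊔ lsuc o) where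
  open Setoid S
  field
    Open          : Pred (Pred Carrier 0ℓ) o
    Open-resp-≈   : ∀ {V} → Open V → V Respects _≈_
    Open-resp-≐   : ∀ {V W} → V ≐ W → Open V → Open W
    Open-U        : Open U
    Open-∩        : ∀ {V W} → Open V → Open W → Open (V ∩ W)
    Open-⋃        : (I : Set) (V : I → Pred Carrier 0ℓ) →
                    (∀ i → Open (V i)) → Open (⋃ I V)

open Topology using (Open)

Continuous : ∀ {S S′ : Setoid 0ℓ 0ℓ} {o o′} → Topology S o → Topology S′ o′ →
             (Setoid.Carrier S → Setoid.Carrier S′) → Set (1ℓ ⊔ o ⊔ o′)
Continuous τ τ′ f = ∀ V → Open τ′ V → Open τ (V ∘ f)

record Homeomorphism {S S′ : Setoid 0ℓ 0ℓ} {o o′}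
                     (τ : Topology S o) (τ′ : Topology S′ o′) :
                     Set (1ℓ ⊔ o ⊔ o′) where
  field
    inverse         : Inverse S S′
  open Inverse inverse public
  field
    to-continuous   : Continuous τ τ′ to
    from-continuous : Continuous τ′ τ from

-- The coarsest topology making every f i continuous: x is interior to V
-- when finitely many conditions "f i y ∈ W, W open" satisfied by x imply
-- y ∈ V.
module _ {o} (S : Setoid 0ℓ 0ℓ) (I : Set) (Y : I → Setoid 0ℓ 0ℓ)
         (τ : ∀ i → Topology (Y i) o) (f : ∀ i → Func S (Y i)) where

  private
    open module S = Setoid S using (Carrier)
    Condition : Set₁
    Condition = Σ I λ i → Pred (Setoid.Carrier (Y i)) 0ℓ

    Satisfies : Carrier → Pred Condition 0ℓ
    Satisfies x (i , W) = W (Func.to (f i) x)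

    OpenCondition : Pred Condition o
    OpenCondition (i , W) = Open (τ i) W

  initial : Topology S (1ℓ ⊔ o)
  initial = record
    { Open        = λ V → ∀ x → x ∈ V → ∃ λ cs →
                      All OpenCondition cs × All (Satisfies x) cs ×
                      (∀ y → All (Satisfies y) cs → y ∈ V)
    ; Open-resp-≈ = λ V-open {x} {y} x≈y x∈V →
        let cs , cs-open , x∈cs , cs⊆V = V-open x x∈V
        in cs⊆V y (All.zipWith
             (λ { {i , W} (W-open , fx∈W) →
                    Topology.Open-resp-≈ (τ i) W-open (Func.cong (f i) x≈y) fx∈W })
             (cs-open , x∈cs))
    ; Open-resp-≐ = λ (V⊆W , W⊆V) V-open x x∈W →
        let cs , cs-open , x∈cs , cs⊆V = V-open x (W⊆V x∈W)
        in cs , cs-open , x∈cs , λ y y∈cs → V⊆W (cs⊆V y y∈cs)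
    ; Open-U      = λ _ _ → [] , [] , [] , λ _ _ → tt
    ; Open-∩      = λ V-open W-open x (x∈V , x∈W) →
        let cs , cs-open , x∈cs , cs⊆V = V-open x x∈V
            ds , ds-open , x∈ds , ds⊆W = W-open x x∈W
        in cs ++ ds , All.++⁺ cs-open ds-open , All.++⁺ x∈cs x∈ds ,
           λ y y∈ → cs⊆V y (All.++⁻ˡ cs y∈) , ds⊆W y (All.++⁻ʳ cs y∈)
    ; Open-⋃      = λ J V V-open x (j , x∈Vj) →
        let cs , cs-open , x∈cs , cs⊆Vj = V-open j x x∈Vj
        in cs , cs-open , x∈cs , λ y y∈cs → j , cs⊆Vj y y∈cs
    }

module _ {S : Setoid 0ℓ 0ℓ} {o} (τ : Topology S o) where

  open Setoid S using (Carrier)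

  subspaceSetoid : Pred Carrier 0ℓ → Setoid 0ℓ 0ℓ
  subspaceSetoid X = On.setoid {B = Σ Carrier X} S proj₁

  subspace : (X : Pred Carrier 0ℓ) → Topology (subspaceSetoid X) (1ℓ ⊔ o)
  subspace X = initial (subspaceSetoid X) ⊤ (λ _ → S) (λ _ → τ)
                       (λ _ → record { to = proj₁ ; cong = λ x≈y → x≈y })

  Connected : Pred Carrier 0ℓ → Set (1ℓ ⊔ o)
  Connected X = Satisfiable X ×
    (∀ V W → Open τ V → Open τ W → X ⊆ V ∪ W → X ≬ V → X ≬ W → X ≬ (V ∩ W))

  infix 4 _IsComponentOf_
  _IsComponentOf_ : ∀ {s} → Pred Carrier 0ℓ → Pred Carrier s → Set (1ℓ ⊔ o ⊔ s)
  X IsComponentOf Z = Connected X × X ⊆ Z ×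
    (∀ Y → Connected Y → Y ⊆ Z → X ⊆ Y → Y ⊆ X)

record ℤ[t] : Set where
  field
    coeff : ℕ → ℤ
    bound : ℕ
    above : ∀ {k} → bound ℕ.≤ k → coeff k ≡ 0ℤ

open ℤ[t] public using (coeff)

infix 4 _≈ₚ_
_≈ₚ_ : Rel ℤ[t] 0ℓ
p ≈ₚ q = ∀ k → coeff p k ≡ coeff q k

0ₚ : ℤ[t]
0ₚ = record { coeff = λ _ → 0ℤ ; bound = 0 ; above = λ _ → refl }

infixl 6 _+ₚ_ _-ₚ_
_+ₚ_ : ℤ[t] → ℤ[t] → ℤ[t]
p +ₚ q = record
  { coeff = λ k → coeff p k ℤ.+ coeff q k
  ; bound = p.bound ℕ.⊔ q.bound
  ; above = λ b≤k → cong₂ ℤ._+_ (p.above (ℕ.m⊔n≤o⇒m≤o _ _ b≤k))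
                                (q.above (ℕ.m⊔n≤o⇒n≤o p.bound _ b≤k))
  } where module p = ℤ[t] p; module q = ℤ[t] q

-ₚ_ : ℤ[t] → ℤ[t]
-ₚ p = record
  { coeff = λ k → ℤ.- coeff p k
  ; bound = ℤ[t].bound p
  ; above = λ b≤k → cong ℤ.-_ (ℤ[t].above p b≤k)
  }

_-ₚ_ : ℤ[t] → ℤ[t] → ℤ[t]
p -ₚ q = p +ₚ -ₚ q

-- m · tᵈ
monomial : ℤ → ℕ → ℤ[t]
monomial m d = record { coeff = at ; bound = suc d ; above = at-above }
  where
  at : ℕ → ℤ
  at k with k ℕ.≟ d
  ... | yes _ = m
  ... | no  _ = 0ℤ

  at-above : ∀ {k} → suc d ℕ.≤ k → at k ≡ 0ℤ
  at-above {k} d<k with k ℕ.≟ d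
  ... | yes refl = contradiction d<k (ℕ.n≮n k)
  ... | no  _    = refl

sumₚ : ∀ {n} → (Fin n → ℤ[t]) → ℤ[t]
sumₚ {zero}  p = 0ₚ
sumₚ {suc n} p = p Fin.zero +ₚ sumₚ (p ∘ Fin.suc)

module Möbius {n} {_⊑_ : Rel (Fin n) 0ℓ}
              (isPartialOrder : IsPartialOrder _≡_ _⊑_)
              (_⊑?_ : Decidable _⊑_) where

  open import Algebra.Properties.CommutativeMonoid.Sum ℤ.+-0-commutativeMonoid
    using (sum)
  open ToStrict _≡_ _⊑_ public using () renaming (_<_ to _⊏_)

  μ-term : (x y : Fin n) → (∀ {z} → z ⊏ y → ℤ) → Fin n → ℤ
  μ-term x y rec z
    with x ⊑? z | ToStrict.<-decidable _≡_ _⊑_ Fin._≟_ _⊑?_ z y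
  ... | yes _ | yes z⊏y = rec z⊏y
  ... | _     | _       = 0ℤ

  -- μ x x = 1, and μ x y = - Σ { μ x z | x ⊑ z ⊏ y } for y ≢ x; in
  -- particular μ x y = 0 unless x ⊑ y.
  μ-step : (x y : Fin n) → (∀ {z} → z ⊏ y → ℤ) → ℤ
  μ-step x y rec with x Fin.≟ y
  ... | yes _ = 1ℤ
  ... | no  _ = ℤ.- sum (μ-term x y rec)

  μ : Fin n → Fin n → ℤ
  μ x = All.wfRec (po-wellFounded isPartialOrder) 0ℓ (λ _ → ℤ) (μ-step x)

ℤ^_ : ℕ → AbelianGroup 0ℓ 0ℓ
ℤ^ n = Pointwise.abelianGroup (Fin n) ℤ.+-0-abelianGroup

record FreeAbelianGroup (n : ℕ) : Set₁ where
  field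
    abelianGroup : AbelianGroup 0ℓ 0ℓ
    basis        : AbelianGroup.Carrier (ℤ^ n) → AbelianGroup.Carrier abelianGroup
    isIso        : IsGroupIsomorphism (AbelianGroup.rawGroup (ℤ^ n))
                                      (AbelianGroup.rawGroup abelianGroup) basis
  open AbelianGroup abelianGroup public

module _ (ℝ : Reals) where

  private
    open module ℝ = Reals ℝ using (_+_; -_; _≈_; _<_; 1#)
    open MonoidMult ℝ.+-monoid using (×-homo-+) renaming (_×_ to _·_)
    open CommutativeSemigroupProperties ℝ.+-commutativeSemigroup
      using (interchange; xy∙z≈xz∙y)
    open AbelianGroupProperties ℝ.+-abelianGroup using (⁻¹-∙-comm)

  ℝ-Open : Pred (Pred ℝ.Carrier 0ℓ) 0ℓ
  ℝ-Open V = V Respects _≈_ ×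
    (∀ x → x ∈ V →
      ∃₂ λ l r → l < x × x < r × (∀ y → l < y → y < r → y ∈ V))

  ℝ-topology : Topology ℝ.setoid 0ℓ
  ℝ-topology = record
    { Open        = ℝ-Open
    ; Open-resp-≈ = proj₁
    ; Open-resp-≐ = λ (V⊆W , W⊆V) (resp , nbhd) →
        (λ x≈y x∈W → V⊆W (resp x≈y (W⊆V x∈W))) ,
        λ x x∈W → let l , r , l<x , x<r , inV = nbhd x (W⊆V x∈W)
                  in l , r , l<x , x<r , λ y l<y y<r → V⊆W (inV y l<y y<r)
    ; Open-U      = (λ _ _ → tt) , λ x _ →
        _ , _ , ℝ.x-1<x x , ℝ.x<x+1 x , λ _ _ _ → tt
    ; Open-∩      = λ (respV , nbhdV) (respW , nbhdW) →
        (λ x≈y (x∈V , x∈W) → respV x≈y x∈V , respW x≈y x∈W) ,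
        λ x (x∈V , x∈W) →
          let l , r , l<x , x<r , inV = nbhdV x x∈V
              l′ , r′ , l′<x , x<r′ , inW = nbhdW x x∈W
              l″ , l″<x , l≤ , l′≤ = larger l<x l′<x
              r″ , x<r″ , ≤r , ≤r′ = smaller x<r x<r′
          in l″ , r″ , l″<x , x<r″ , λ y l″<y y<r″ →
               inV y (ℝ.≤-<-trans l≤ l″<y) (ℝ.<-≤-trans y<r″ ≤r) ,
               inW y (ℝ.≤-<-trans l′≤ l″<y) (ℝ.<-≤-trans y<r″ ≤r′)
    ; Open-⋃      = λ I V V-open →
        (λ x≈y (i , x∈Vi) → i , proj₁ (V-open i) x≈y x∈Vi) ,
        λ x (i , x∈Vi) →
          let l , r , l<x , x<r , inVi = proj₂ (V-open i) x x∈Vi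
          in l , r , l<x , x<r , λ y l<y y<r → i , inVi y l<y y<r
    }
    where
    larger : ∀ {l l′ x} → l < x → l′ < x →
             ∃ λ l″ → l″ < x × l ℝ.≤ l″ × l′ ℝ.≤ l″
    larger {l} {l′} l<x l′<x with ℝ.total l l′
    ... | inj₁ l≤l′ = l′ , l′<x , l≤l′ , ℝ.≤-refl
    ... | inj₂ l′≤l = l , l<x , ℝ.≤-refl , l′≤l

    smaller : ∀ {r r′ x} → x < r → x < r′ →
              ∃ λ r″ → x < r″ × r″ ℝ.≤ r × r″ ℝ.≤ r′
    smaller {r} {r′} x<r x<r′ with ℝ.total r r′
    ... | inj₁ r≤r′ = r , x<r , ℝ.≤-refl , r≤r′
    ... | inj₂ r′≤r = r′ , x<r′ , r′≤r , ℝ.≤-refl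

  -- S¹ = ℝ / ℤ: x and y are identified when they differ by an integer,
  -- written as a difference of two naturals.
  infix 4 _∼_
  _∼_ : Rel ℝ.Carrier 0ℓ
  x ∼ y = ∃₂ λ m n → x + m · 1# ≈ y + n · 1#

  private
    ∼-trans : ∀ {x y z} → x ∼ y → y ∼ z → x ∼ z
    ∼-trans {x} {y} {z} (m , n , p) (m′ , n′ , q) = m ℕ.+ m′ , n ℕ.+ n′ ,
      (begin
        x + (m ℕ.+ m′) · 1#        ≈⟨ ℝ.+-congˡ (×-homo-+ 1# m m′) ⟩
        x + (m · 1# + m′ · 1#)     ≈⟨ ℝ.+-assoc _ _ _ ⟨
        x + m · 1# + m′ · 1#       ≈⟨ ℝ.+-congʳ p ⟩
        y + n · 1# + m′ · 1#       ≈⟨ xy∙z≈xz∙y _ _ _ ⟩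
        y + m′ · 1# + n · 1#       ≈⟨ ℝ.+-congʳ q ⟩
        z + n′ · 1# + n · 1#       ≈⟨ xy∙z≈xz∙y _ _ _ ⟩
        z + n · 1# + n′ · 1#       ≈⟨ ℝ.+-assoc _ _ _ ⟩
        z + (n · 1# + n′ · 1#)     ≈⟨ ℝ.+-congˡ (×-homo-+ 1# n n′) ⟨
        z + (n ℕ.+ n′) · 1#        ∎)
      where open ≈-Reasoning ℝ.setoid

    +-cong-∼ : ∀ {x y u v} → x ∼ y → u ∼ v → x + u ∼ y + v
    +-cong-∼ {x} {y} {u} {v} (m , n , p) (m′ , n′ , q) =
      m ℕ.+ m′ , n ℕ.+ n′ ,
      (begin
        x + u + (m ℕ.+ m′) · 1#    ≈⟨ ℝ.+-congˡ (×-homo-+ 1# m m′) ⟩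
        x + u + (m · 1# + m′ · 1#) ≈⟨ interchange _ _ _ _ ⟩
        x + m · 1# + (u + m′ · 1#) ≈⟨ ℝ.+-cong p q ⟩
        y + n · 1# + (v + n′ · 1#) ≈⟨ interchange _ _ _ _ ⟩
        y + v + (n · 1# + n′ · 1#) ≈⟨ ℝ.+-congˡ (×-homo-+ 1# n n′) ⟨
        y + v + (n ℕ.+ n′) · 1#    ∎)
      where open ≈-Reasoning ℝ.setoid

    -‿cong-∼ : ∀ {x y} → x ∼ y → - x ∼ - y
    -‿cong-∼ {x} {y} (m , n , p) = n , m ,
      (begin
        - x + n · 1#                    ≈⟨ shift x m n ⟩
        - (x + m · 1#) + (m · 1# + n · 1#) ≈⟨ ℝ.+-cong (ℝ.-‿cong p) (ℝ.+-comm _ _) ⟩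
        - (y + n · 1#) + (n · 1# + m · 1#) ≈⟨ shift y n m ⟨
        - y + m · 1#                    ∎)
      where
      open ≈-Reasoning ℝ.setoid
      shift : ∀ x m n → - x + n · 1# ≈ - (x + m · 1#) + (m · 1# + n · 1#)
      shift x m n = begin
        - x + n · 1#                              ≈⟨ ℝ.+-congˡ (ℝ.+-identityˡ _) ⟨
        - x + (ℝ.0# + n · 1#)                     ≈⟨ ℝ.+-congˡ (ℝ.+-congʳ (ℝ.-‿inverseˡ _)) ⟨
        - x + (- (m · 1#) + m · 1# + n · 1#)      ≈⟨ ℝ.+-congˡ (ℝ.+-assoc _ _ _) ⟩
        - x + (- (m · 1#) + (m · 1# + n · 1#))    ≈⟨ ℝ.+-assoc _ _ _ ⟨
        - x + - (m · 1#) + (m · 1# + n · 1#)      ≈⟨ ℝ.+-congʳ (⁻¹-∙-comm _ _) ⟩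
        - (x + m · 1#) + (m · 1# + n · 1#)        ∎

    ≈⇒∼ : ∀ {x y} → x ≈ y → x ∼ y
    ≈⇒∼ x≈y = 0 , 0 , ℝ.+-congʳ x≈y

  circle : AbelianGroup 0ℓ 0ℓ
  circle = record
    { Carrier = ℝ.Carrier ; _≈_ = _∼_ ; _∙_ = _+_ ; ε = ℝ.0# ; _⁻¹ = -_
    ; isAbelianGroup = record
      { isGroup = record
        { isMonoid = record
          { isSemigroup = record
            { isMagma = record
              { isEquivalence = record
                { refl  = ≈⇒∼ ℝ.refl
                ; sym   = λ (m , n , p) → n , m , ℝ.sym p
                ; trans = ∼-trans
                }
              ; ∙-cong = +-cong-∼
              }
            ; assoc = λ x y z → ≈⇒∼ (ℝ.+-assoc x y z)
            }
          ; identity = (λ x → ≈⇒∼ (ℝ.+-identityˡ x)) ,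
                       (λ x → ≈⇒∼ (ℝ.+-identityʳ x))
          }
        ; inverse = (λ x → ≈⇒∼ (ℝ.-‿inverseˡ x)) ,
                    (λ x → ≈⇒∼ (ℝ.-‿inverseʳ x))
        ; ⁻¹-cong = -‿cong-∼
        }
      ; comm = λ x y → ≈⇒∼ (ℝ.+-comm x y)
      }
    }

  -- The quotient topology: a subset of ℝ / ℤ is open when its preimage
  -- in ℝ is.
  circle-topology : Topology (AbelianGroup.setoid circle) 0ℓ
  circle-topology = record
    { Open        = λ V → V Respects _∼_ × ℝ-Open V
    ; Open-resp-≈ = proj₁
    ; Open-resp-≐ = λ V≐W@(V⊆W , W⊆V) (resp , V-open) →
        (λ x∼y x∈W → V⊆W (resp x∼y (W⊆V x∈W))) ,
        τ.Open-resp-≐ V≐W V-open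
    ; Open-U      = (λ _ _ → tt) , τ.Open-U
    ; Open-∩      = λ (respV , V-open) (respW , W-open) →
        (λ x∼y (x∈V , x∈W) → respV x∼y x∈V , respW x∼y x∈W) ,
        τ.Open-∩ V-open W-open
    ; Open-⋃      = λ I V V-open →
        (λ x∼y (i , x∈Vi) → i , proj₁ (V-open i) x∼y x∈Vi) ,
        τ.Open-⋃ I V (proj₂ ∘ V-open)
    } where module τ = Topology ℝ-topology

  ℝ^_ : ℕ → AbelianGroup 0ℓ 0ℓ
  ℝ^ d = Pointwise.abelianGroup (Fin d) ℝ.+-abelianGroup

  ℝ^-topology : ∀ d → Topology (AbelianGroup.setoid (ℝ^ d)) 1ℓ
  ℝ^-topology d = initial _ (Fin d) (λ _ → ℝ.setoid) (λ _ → ℝ-topology)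
    (λ i → record { to = λ v → v i ; cong = λ v≈w → v≈w i })

  model : ℕ → ℕ → AbelianGroup 0ℓ 0ℓ
  model a b = DirectProduct.abelianGroup
    (Pointwise.abelianGroup (Fin a) circle) (ℝ^ b)

  model-topology : ∀ a b → Topology (AbelianGroup.setoid (model a b)) 1ℓ
  model-topology a b = initial _ (Fin a ⊎ Fin b)
    (λ { (inj₁ _) → AbelianGroup.setoid circle ; (inj₂ _) → ℝ.setoid })
    (λ { (inj₁ _) → circle-topology ; (inj₂ _) → ℝ-topology })
    (λ { (inj₁ i) → record { to = λ p → proj₁ p i ; cong = λ p≈q → proj₁ p≈q i }
       ; (inj₂ j) → record { to = λ p → proj₂ p j ; cong = λ p≈q → proj₂ p≈q j } })

  -- A group isomorphic, as a topological group, to (S¹)ᵃ × ℝᵇ.  The smooth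
  -- structure and continuity of the operations are inherited along the
  -- isomorphism and are not recorded separately.
  record ConnectedAbelianLieGroup (a b : ℕ) : Set₂ where
    field
      abelianGroup  : AbelianGroup 0ℓ 0ℓ
      topology      : Topology (AbelianGroup.setoid abelianGroup) 1ℓ
      homeomorphism : Homeomorphism (model-topology a b) topology
      isHomomorphism : IsGroupHomomorphism
        (AbelianGroup.rawGroup (model a b)) (AbelianGroup.rawGroup abelianGroup)
        (Homeomorphism.to homeomorphism)
    open AbelianGroup abelianGroup public

  -- X is a topological d-manifold: every point has a neighbourhood in X
  -- homeomorphic to ℝᵈ.
  HasDimension : ∀ {S o} (τ : Topology S o) →
                 Pred (Setoid.Carrier S) 0ℓ → ℕ → Set (1ℓ ⊔ o)
  HasDimension τ X d = ∀ x → x ∈ X → ∃ λ V → Open τ V × x ∈ V ×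
    Homeomorphism (subspace τ (X ∩ V)) (ℝ^-topology d)

module Layers (lem : ∀ {ℓ} → ExcludedMiddle ℓ) (ℝ : Reals)
              {S : Setoid 0ℓ 0ℓ} (τ : Topology S 1ℓ) where

  Subset : Set₁
  Subset = Pred (Setoid.Carrier S) 0ℓ

  Family : Set₂
  Family = Pred Subset 1ℓ

  -- dim X is the d such that X is a d-manifold (0 if there is none); asking
  -- for the least one makes it well defined without invariance of domain.
  dim : Subset → ℕ
  dim X with lem {P = ∃ λ d → HasDimension ℝ τ X d ×
                       (∀ e → HasDimension ℝ τ X e → d ℕ.≤ e)}
  ... | yes (d , _) = d
  ... | no  _       = 0

  -- The layers of 𝓕 inside the ambient space W: the components of the
  -- intersections of subfamilies B of 𝓕, where the empty family has
  -- intersection W.  Components are nonempty by definition.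
  Layer : Subset → Family → Family
  Layer W 𝓕 X = ∃ λ (B : Pred Subset 0ℓ) → B ⊆ 𝓕 ×
    _IsComponentOf_ τ X (λ x → x ∈ W × (∀ Y → Y ∈ B → x ∈ Y))

  -- The poset of layers, enumerated without repetition (up to equality of
  -- subsets), with its minimum W.
  record LayerPoset (W : Subset) (𝓕 : Family) : Set₁ where
    field
      size      : ℕ
      layer     : Fin size → Subset
      isLayer   : ∀ i → layer i ∈ Layer W 𝓕
      distinct  : ∀ {i j} → layer i ≐ layer j → i ≡ j
      complete  : ∀ {X} → X ∈ Layer W 𝓕 → ∃ λ i → layer i ≐ X
      minimum   : Fin size
      minimum≐W : layer minimum ≐ W

    infix 4 _⊑_
    _⊑_ : Rel (Fin size) 0ℓ
    i ⊑ j = layer j ⊆ layer i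

    ⊑-isPartialOrder : IsPartialOrder _≡_ _⊑_
    ⊑-isPartialOrder = record
      { isPreorder = record
        { isEquivalence = isEquivalence
        ; reflexive     = λ { refl → λ x∈ → x∈ }
        ; trans         = λ i⊑j j⊑k x∈ → i⊑j (j⊑k x∈)
        }
      ; antisym = λ i⊑j j⊑i → distinct (j⊑i , i⊑j)
      }

    open Möbius ⊑-isPartialOrder (λ _ _ → lem) public using (μ)

    characteristicPolynomial : ℤ[t]
    characteristicPolynomial =
      sumₚ λ i → monomial (μ minimum i) (dim (layer i))

  -- The sum over all layers; it is 0 by convention if there are infinitely
  -- many of them, which does not happen for abelian arrangements.
  χ : Subset → Family → ℤ[t]
  χ W 𝓕 with lem {P = LayerPoset W 𝓕}
  ... | yes L = LayerPoset.characteristicPolynomial L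
  ... | no  _ = 0ₚ

  deletion : Family → Subset → Family
  deletion 𝓕 H K = K ∈ 𝓕 × ¬ K ≐ H

  restriction : Family → Subset → Family
  restriction 𝓕 H X =
    ∃ λ K → K ∈ deletion 𝓕 H × _IsComponentOf_ τ X (K ∩ H)

module Arrangement (ℝ : Reals) {a b : ℕ} (G : ConnectedAbelianLieGroup ℝ a b)
                   {ℓ : ℕ} (Γ : FreeAbelianGroup ℓ) where

  private
    module G = ConnectedAbelianLieGroup G
    module Γ = FreeAbelianGroup Γ

  Hom : Set
  Hom = GroupHomomorphism Γ.rawGroup G.rawGroup

  open GroupHomomorphism using (⟦_⟧)

  T : Setoid 0ℓ 0ℓ
  T = record
    { Carrier       = Hom
    ; _≈_           = λ φ ψ → ∀ γ → ⟦ φ ⟧ γ G.≈ ⟦ ψ ⟧ γ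
    ; isEquivalence = record
      { refl  = λ _ → G.refl
      ; sym   = λ φ≈ψ γ → G.sym (φ≈ψ γ)
      ; trans = λ φ≈ψ ψ≈χ γ → G.trans (φ≈ψ γ) (ψ≈χ γ)
      }
    }

  -- Pointwise convergence; evaluation at a basis of Γ identifies this with
  -- the product topology of Gˡ.
  T-topology : Topology T 1ℓ
  T-topology = initial T Γ.Carrier (λ _ → G.setoid) (λ _ → G.topology)
    (λ γ → record { to = λ φ → ⟦ φ ⟧ γ ; cong = λ φ≈ψ → φ≈ψ γ })

  NonZeroCharacter : Set
  NonZeroCharacter = Σ Γ.Carrier λ α → ¬ α Γ.≈ Γ.ε

  hypersurface : NonZeroCharacter × G.Carrier → Pred Hom 0ℓ
  hypersurface ((α , _) , c) φ = ⟦ φ ⟧ α G.≈ c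

  arrangement : List (NonZeroCharacter × G.Carrier) → Pred (Pred Hom 0ℓ) 1ℓ
  arrangement 𝒜 X =
    Any (λ p → _IsComponentOf_ T-topology X (hypersurface p)) 𝒜

module Submission where

-- Extend the Möbius functions μ′ and μ″ of the deletion and of the
-- restriction by zero to the layers of 𝒜.  Then μ′ - μ″ satisfies the
-- recursion of the Möbius function μ of 𝒜: for a layer X, the sum of μ′
-- over the layers of 𝒜′ containing X is 1 if the smallest such layer is T
-- and 0 otherwise, the sum of μ″ over the layers of 𝒜″ containing X is 1
-- if X = H and 0 otherwise, and the smallest layer of 𝒜′ containing X is
-- T exactly when X is T or H.  The topology enters in three places.  T is
-- connected, since homomorphisms Γ → G lift to Γ → ℝ^(a+b) and can be
-- joined by lines.  There are finitely many layers, since two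
-- homomorphisms on the same hypersurfaces, with lifts close enough, are
-- joined by a line inside all these hypersurfaces.  Finally no component
-- of a hypersurface contains another one: if H lies in a component K of
-- H_{β,d}, then β is proportional to α, so that on K evaluation at α
-- varies in a translate of a finite torsion group, hence is constant.

open import Algebra.Bundles using (AbelianGroup; CommutativeRing)
open import Algebra.Morphism.Bundles using (GroupHomomorphism)
open import Algebra.Morphism.Structures using (IsGroupHomomorphism; IsGroupIsomorphism)
import Algebra.Properties.AbelianGroup as AbelianGroupProperties
import Algebra.Properties.CommutativeMonoid.Sum as CommutativeMonoidSum
import Algebra.Properties.Ring as RingProperties
import Algebra.Properties.Semiring.Mult as SemiringMult
import Algebra.Properties.Semiring.Sum as SemiringSum
import Algebra.Solver.Ring as RingSolver
open import Algebra.Solver.Ring.AlmostCommutativeRing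
  using (fromCommutativeRing; Induced-equivalence; _-Raw-AlmostCommutative⟶_)
open import Axiom.ExcludedMiddle using (ExcludedMiddle)
open import Data.Empty using (⊥; ⊥-elim)
open import Data.Fin.Base
  using (Fin; zero; suc; toℕ; fromℕ<; combine; finToFun; funToFin)
open import Data.Fin.Induction using (po-wellFounded)
import Data.Fin.Properties as Fin
open import Data.Integer.Base as ℤ using (ℤ; 0ℤ; 1ℤ; +_; -[1+_]; _⊖_)
import Data.Integer.DivMod as ℤ
import Data.Integer.Properties as ℤ
open import Data.List.Base using (List; []; _∷_; length; lookup)
open import Data.List.Relation.Unary.All using (All; []; _∷_)
open import Data.List.Relation.Unary.Any as Any using (Any)
open import Data.List.Relation.Unary.Any.Properties using (lookup-index)
open import Data.Maybe.Base using (just; nothing)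
open import Data.Nat.Base as ℕ using (ℕ; zero; suc)
import Data.Nat.Properties as ℕ
open import Data.Product using (Σ; ∃; ∃₂; _×_; _,_; proj₁; proj₂)
open import Data.Sum.Base using (_⊎_; inj₁; inj₂)
open import Data.Unit.Base using (⊤; tt)
open import Function.Base using (_∘_; id)
open import Induction.WellFounded using (module All; module FixPoint)
open import Level using (Level; 0ℓ; _⊔_)
open import Relation.Binary.Bundles using (Setoid)
open import Relation.Binary.Core using (Rel)
import Relation.Binary.Construct.NonStrictToStrict as ToStrict
open import Relation.Binary.Definitions using (Decidable; WeaklyDecidable)
open import Relation.Binary.PropositionalEquality as ≡ using (_≡_; _≗_)
import Relation.Binary.Reasoning.Setoid as ≈-Reasoning
open import Relation.Binary.Structures using (IsPartialOrder)
open import Relation.Nullary using (¬_; Dec; yes; no)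
open import Relation.Nullary.Decidable using (True; toWitness; fromWitness)
open import Relation.Nullary.Negation using (contradiction)
open import Relation.Unary using (Pred; _∈_; _⊆_; _≐_; _≬_; _∩_; _∪_; ⋃; U)
import Algebra.Properties.AbelianGroup ℤ.+-0-abelianGroup as ℤ-group
open import Defs
open Topology using (Open)

-- The poset argument is carried out for an arbitrary family of subsets with finitely many layers,
-- under these conditions: the ambient space and `H` are connected, no member is the whole space,
-- and no other member contains `H`. The last condition is the delicate one. For a family of two
-- sets `H` and `K` with `H` strictly inside `K`, the layer `H` has Möbius value 0, while the
-- formula would give -1; excluding this for components of hypersurfaces is what calls for the
-- torsion argument. Dimensions are never computed. Every layer of the deletion or restriction is,
-- as a subset of `T`, a layer of the arrangement, and `dim` depends only on the subset, so the
-- identity of polynomials reduces to one of Möbius values. Two functions on a finite poset coincide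
-- once their sums over all down-sets do, which is why it is enough to compare such sums.

module Combinatorics where

  open ≡ using (refl; sym; trans; cong; cong₂; module ≡-Reasoning)
  open CommutativeMonoidSum ℤ.+-0-commutativeMonoid
    using (sum; sum-cong-≗; sum-replicate-zero; ∑-distrib-+; ∑-comm)

  private variable
    p q : Level
    P Q : Set p
    m n : ℕ

  -- Integer sums weighted by indicators.

  when : Dec P → ℤ → ℤ
  when (yes _) z = z
  when (no  _) _ = 0ℤ

  when-yes : (P? : Dec P) → P → ∀ z → when P? z ≡ z
  when-yes (yes _) _ _ = refl
  when-yes (no ¬p) x _ = contradiction x ¬p

  when-no : (P? : Dec P) → ¬ P → ∀ z → when P? z ≡ 0ℤ
  when-no (yes x) ¬p _ = contradiction x ¬p
  when-no (no _)  _  _ = refl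

  when-⇔ : {P : Set p} {Q : Set q} (P? : Dec P) (Q? : Dec Q) →
           (P → Q) → (Q → P) → ∀ z → when P? z ≡ when Q? z
  when-⇔ (yes x) Q? f g z = sym (when-yes Q? (f x) z)
  when-⇔ (no ¬p) Q? f g z = sym (when-no Q? (¬p ∘ g) z)

  when-+ : (P? : Dec P) → ∀ x y → when P? (x ℤ.+ y) ≡ when P? x ℤ.+ when P? y
  when-+ (yes _) _ _ = refl
  when-+ (no _)  _ _ = refl

  when-neg : (P? : Dec P) → ∀ x → when P? (ℤ.- x) ≡ ℤ.- when P? x
  when-neg (yes _) _ = refl
  when-neg (no _)  _ = refl

  when-comm : (P? : Dec P) (Q? : Dec Q) → ∀ z →
              when P? (when Q? z) ≡ when Q? (when P? z)
  when-comm (yes _) (yes _) _ = refl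
  when-comm (yes _) (no _)  _ = refl
  when-comm (no _)  (yes _) _ = refl
  when-comm (no _)  (no _)  _ = refl

  sum-zero : {f : Fin n → ℤ} → (∀ i → f i ≡ 0ℤ) → sum f ≡ 0ℤ
  sum-zero {n} f≡0 = trans (sum-cong-≗ f≡0) (sum-replicate-zero n)

  when-sum : (P? : Dec P) (f : Fin n → ℤ) → when P? (sum f) ≡ sum (λ i → when P? (f i))
  when-sum (yes _) f = refl
  when-sum {n = n} (no _)  f = sym (sum-replicate-zero n)

  sum-neg : (f : Fin n → ℤ) → sum (λ i → ℤ.- f i) ≡ ℤ.- sum f
  sum-neg {zero}  f = refl
  sum-neg {suc n} f = trans (cong (ℤ._+_ (ℤ.- f zero)) (sum-neg (f ∘ suc)))
                            (sym (ℤ.neg-distrib-+ (f zero) _))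

  sum-when-≟ : (i : Fin n) (f : Fin n → ℤ) →
               sum (λ j → when (i Fin.≟ j) (f j)) ≡ f i
  sum-when-≟ {suc n} zero f =
    trans (cong₂ ℤ._+_ (when-yes (zero {n} Fin.≟ zero) refl (f zero))
                       (sum-zero (λ j → when-no (zero Fin.≟ suc j) (λ ()) (f (suc j)))))
          (ℤ.+-identityʳ _)
  sum-when-≟ {suc n} (suc i) f =
    trans (cong₂ ℤ._+_ (when-no (suc i Fin.≟ zero) (λ ()) (f zero))
                       (trans (sum-cong-≗ λ j → when-⇔ (suc i Fin.≟ suc j) (i Fin.≟ j)
                                  Fin.suc-injective (cong suc) (f (suc j)))
                              (sum-when-≟ i (f ∘ suc))))
          (ℤ.+-identityˡ _)

  -- For injective `e` this is extension by zero. Summing over fibres makes sense for every `e`, so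
  -- injectivity never has to be established.
  pushforward : (Fin m → Fin n) → (Fin m → ℤ) → Fin n → ℤ
  pushforward e h i = sum λ j → when (e j Fin.≟ i) (h j)

  -- After exchanging the two sums, the inner one has `e j` as the only index that contributes.
  sum-pushforward : {P : Fin n → Set p} (P? : ∀ i → Dec (P i))
                    (e : Fin m → Fin n) (h : Fin m → ℤ) →
                    sum (λ i → when (P? i) (pushforward e h i)) ≡
                    sum (λ j → when (P? (e j)) (h j))
  sum-pushforward P? e h = begin
    sum (λ i → when (P? i) (pushforward e h i))
      ≡⟨ sum-cong-≗ (λ i → when-sum (P? i) (λ j → when (e j Fin.≟ i) (h j))) ⟩
    sum (λ i → sum λ j → when (P? i) (when (e j Fin.≟ i) (h j)))
      ≡⟨ ∑-comm (λ i j → when (P? i) (when (e j Fin.≟ i) (h j))) ⟩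
    sum (λ j → sum λ i → when (P? i) (when (e j Fin.≟ i) (h j)))
      ≡⟨ sum-cong-≗ (λ j → sum-cong-≗ λ i → when-comm (P? i) (e j Fin.≟ i) (h j)) ⟩
    sum (λ j → sum λ i → when (e j Fin.≟ i) (when (P? i) (h j)))
      ≡⟨ sum-cong-≗ (λ j → sum-when-≟ (e j) (λ i → when (P? i) (h j))) ⟩
    sum (λ j → when (P? (e j)) (h j))
      ∎
    where open ≡-Reasoning

  sum-when-difference :
    {P : Fin n → Set p} (P? : ∀ i → Dec (P i)) (f g : Fin n → ℤ) →
    sum (λ i → when (P? i) (f i ℤ.- g i)) ≡
    sum (λ i → when (P? i) (f i)) ℤ.- sum (λ i → when (P? i) (g i))
  sum-when-difference P? f g = begin
    sum (λ i → when (P? i) (f i ℤ.- g i))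
      ≡⟨ sum-cong-≗ (λ i → trans (when-+ (P? i) (f i) (ℤ.- g i))
                            (cong (ℤ._+_ (when (P? i) (f i))) (when-neg (P? i) (g i)))) ⟩
    sum (λ i → when (P? i) (f i) ℤ.- when (P? i) (g i))
      ≡⟨ ∑-distrib-+ (λ i → when (P? i) (f i)) _ ⟩
    sum (λ i → when (P? i) (f i)) ℤ.+ sum (λ i → ℤ.- when (P? i) (g i))
      ≡⟨ cong (λ s → sum (λ i → when (P? i) (f i)) ℤ.+ s) (sum-neg (λ i → when (P? i) (g i))) ⟩
    sum (λ i → when (P? i) (f i)) ℤ.- sum (λ i → when (P? i) (g i)) ∎
    where open ≡-Reasoning

  -- Möbius functions as solutions of a triangular system.

  module MöbiusProperties {n} {_⊑_ : Rel (Fin n) 0ℓ}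
    (isPartialOrder : IsPartialOrder _≡_ _⊑_) (_⊑?_ : Decidable _⊑_) where

    open Möbius isPartialOrder _⊑?_ public
    private module PO = IsPartialOrder isPartialOrder

    _⊏?_ : Decidable _⊏_
    _⊏?_ = ToStrict.<-decidable _≡_ _⊑_ Fin._≟_ _⊑?_

    sum-⊑-split : (f : Fin n → ℤ) (y : Fin n) →
      sum (λ z → when (z ⊑? y) (f z)) ≡ f y ℤ.+ sum (λ z → when (z ⊏? y) (f z))
    sum-⊑-split f y = begin
      sum (λ z → when (z ⊑? y) (f z))
        ≡⟨ sum-cong-≗ split ⟩
      sum (λ z → when (y Fin.≟ z) (f z) ℤ.+ when (z ⊏? y) (f z))
        ≡⟨ ∑-distrib-+ (λ z → when (y Fin.≟ z) (f z)) _ ⟩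
      sum (λ z → when (y Fin.≟ z) (f z)) ℤ.+ sum (λ z → when (z ⊏? y) (f z))
        ≡⟨ cong (ℤ._+ sum (λ z → when (z ⊏? y) (f z))) (sum-when-≟ y f) ⟩
      f y ℤ.+ sum (λ z → when (z ⊏? y) (f z)) ∎
      where
      open ≡-Reasoning
      split : ∀ z → when (z ⊑? y) (f z) ≡
                    when (y Fin.≟ z) (f z) ℤ.+ when (z ⊏? y) (f z)
      split z with y Fin.≟ z
      ... | yes refl = trans (when-yes (y ⊑? y) PO.refl (f y))
                      (trans (sym (ℤ.+-identityʳ (f y)))
                             (cong (ℤ._+_ (f y)) (sym (when-no (y ⊏? y) (λ y⊏y → proj₂ y⊏y refl) (f y)))))
      ... | no y≢z = trans (when-⇔ (z ⊑? y) (z ⊏? y) (λ z⊑y → z⊑y , y≢z ∘ sym) proj₁ (f z))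
                           (sym (ℤ.+-identityˡ _))

    -- The sums form a unitriangular system: if `f` and `g` agree strictly below `y`, cancelling
    -- those terms leaves `f y ≡ g y`.
    sum-⊑-injective : {f g : Fin n → ℤ} →
      (∀ y → sum (λ z → when (z ⊑? y) (f z)) ≡ sum (λ z → when (z ⊑? y) (g z))) →
      ∀ y → f y ≡ g y
    sum-⊑-injective {f} {g} eq = All.wfRec (po-wellFounded isPartialOrder) 0ℓ _
      λ y ih → ℤ-group.∙-cancelʳ (sum λ z → when (z ⊏? y) (f z)) (f y) (g y) (begin
        f y ℤ.+ sum (λ z → when (z ⊏? y) (f z)) ≡⟨ sum-⊑-split f y ⟨
        sum (λ z → when (z ⊑? y) (f z))         ≡⟨ eq y ⟩
        sum (λ z → when (z ⊑? y) (g z))         ≡⟨ sum-⊑-split g y ⟩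
        g y ℤ.+ sum (λ z → when (z ⊏? y) (g z)) ≡⟨ cong (ℤ._+_ (g y)) (sum-cong-≗ (λ z → same y z ih)) ⟨
        g y ℤ.+ sum (λ z → when (z ⊏? y) (f z)) ∎)
      where
      open ≡-Reasoning
      same : ∀ y z → (∀ {z} → z ⊏ y → f z ≡ g z) →
             when (z ⊏? y) (f z) ≡ when (z ⊏? y) (g z)
      same y z ih with z ⊏? y
      ... | yes z⊏y = ih z⊏y
      ... | no _    = refl

    module _ (x : Fin n) (x-min : ∀ y → x ⊑ y) where

      private
        -- `μ-term` also tests `x ⊑ z`, which always succeeds since `x` is the minimum.
        μ-term-when : ∀ y (rec : ∀ {z} → z ⊏ y → ℤ) (f : Fin n → ℤ) →
          (∀ {z} (z⊏y : z ⊏ y) → rec z⊏y ≡ f z) →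
          ∀ z → μ-term x y rec z ≡ when (z ⊏? y) (f z)
        μ-term-when y rec f eq z with x ⊑? z | z ⊏? y
        ... | yes _  | yes z⊏y = eq z⊏y
        ... | yes _  | no _    = refl
        ... | no x⋢z | _       = contradiction (x-min z) x⋢z

        μ-step-when : ∀ y (rec : ∀ {z} → z ⊏ y → ℤ) (f : Fin n → ℤ) →
          (∀ {z} (z⊏y : z ⊏ y) → rec z⊏y ≡ f z) →
          μ-step x y rec ≡ when (x Fin.≟ y) 1ℤ ℤ.- sum (λ z → when (z ⊏? y) (f z))
        μ-step-when y rec f eq with x Fin.≟ y
        -- Nothing lies strictly below the minimum, so the sum to be subtracted vanishes.
        ... | yes refl = sym (cong (λ s → 1ℤ ℤ.- s)
                (sum-zero λ z → when-no (z ⊏? x)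
                  (λ (z⊑x , z≢x) → z≢x (PO.antisym z⊑x (x-min z))) (f z)))
        ... | no _ = trans (cong ℤ.-_ (sum-cong-≗ (μ-term-when y rec f eq)))
                           (sym (ℤ.+-identityˡ _))

        -- Unfolding a well-founded recursion requires that a step depend on the recursive values
        -- only pointwise.
        μ-step-ext : ∀ y {r r′ : ∀ {z} → z ⊏ y → ℤ} →
          (∀ {z} (z⊏y : z ⊏ y) → r z⊏y ≡ r′ z⊏y) → μ-step x y r ≡ μ-step x y r′
        μ-step-ext y {r} {r′} eq with x Fin.≟ y
        ... | yes _ = refl
        ... | no _  = cong ℤ.-_ (sum-cong-≗ term-ext)
          where
          term-ext : ∀ z → μ-term x y r z ≡ μ-term x y r′ z
          term-ext z with x ⊑? z | z ⊏? y
          ... | yes _ | yes z⊏y = eq z⊏y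
          ... | yes _ | no _    = refl
          ... | no _  | yes _   = refl
          ... | no _  | no _    = refl

      sum-μ : ∀ y → sum (λ z → when (z ⊑? y) (μ x z)) ≡ when (x Fin.≟ y) 1ℤ
      sum-μ y = begin
        sum (λ z → when (z ⊑? y) (μ x z))   ≡⟨ sum-⊑-split (μ x) y ⟩
        μ x y ℤ.+ below
          ≡⟨ cong (ℤ._+ below) (FixPoint.unfold-wfRec (po-wellFounded isPartialOrder)
               (λ _ → ℤ) (μ-step x) μ-step-ext) ⟩
        μ-step x y (λ {z} _ → μ x z) ℤ.+ below
          ≡⟨ cong (ℤ._+ below) (μ-step-when y _ (μ x) (λ _ → refl)) ⟩
        δ ℤ.- below ℤ.+ below               ≡⟨ ℤ.+-assoc δ (ℤ.- below) below ⟩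
        δ ℤ.+ (ℤ.- below ℤ.+ below)         ≡⟨ cong (ℤ._+_ δ) (ℤ.+-inverseˡ below) ⟩
        δ ℤ.+ 0ℤ                            ≡⟨ ℤ.+-identityʳ δ ⟩
        δ                                   ∎
        where
        open ≡-Reasoning
        δ = when (x Fin.≟ y) 1ℤ
        below = sum (λ z → when (z ⊏? y) (μ x z))

  -- This gives a coefficient the shape of the sums in the Möbius recursion, filtered by a decidable
  -- condition, so that `sum-pushforward` applies to both.
  coeff-sum-monomials : (c : Fin n → ℤ) (d : Fin n → ℕ) (k : ℕ) →
    coeff (sumₚ λ i → monomial (c i) (d i)) k ≡ sum (λ i → when (k ℕ.≟ d i) (c i))
  coeff-sum-monomials {zero}  c d k = refl
  coeff-sum-monomials {suc n} c d k =
    cong₂ ℤ._+_ at (coeff-sum-monomials (c ∘ suc) (d ∘ suc) k)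
    where
    at : coeff (monomial (c zero) (d zero)) k ≡ when (k ℕ.≟ d zero) (c zero)
    at with k ℕ.≟ d zero
    ... | yes _ = refl
    ... | no _  = refl

  -- Finite codes and enumeration of decidable subsets.

  bit : ∀ {p} {P : Set p} → Dec P → Fin 2
  bit (yes _) = suc zero
  bit (no _)  = zero

  bit-injective : ∀ {p q} {P : Set p} {Q : Set q} (P? : Dec P) (Q? : Dec Q) →
                  bit P? ≡ bit Q? → P → Q
  bit-injective (yes _) (yes q) _ _ = q
  bit-injective (no ¬p) _ _ p = contradiction p ¬p

  bit-cong : ∀ {p q} {P : Set p} {Q : Set q} (P? : Dec P) (Q? : Dec Q) →
             (P → Q) → (Q → P) → bit P? ≡ bit Q?
  bit-cong (yes _) (yes _) _ _ = refl
  bit-cong (yes p) (no ¬q) f _ = contradiction (f p) ¬q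
  bit-cong (no ¬p) (yes q) _ g = contradiction (g q) ¬p
  bit-cong (no _)  (no _)  _ _ = refl

  funToFin-cong : {f g : Fin m → Fin n} → f ≗ g → funToFin f ≡ funToFin g
  funToFin-cong {m = zero}  _   = refl
  funToFin-cong {m = suc m} f≗g = cong₂ combine (f≗g zero) (funToFin-cong (f≗g ∘ suc))

  funToFin-injective : {f g : Fin m → Fin n} → funToFin f ≡ funToFin g → f ≗ g
  funToFin-injective {f = f} {g} eq i = trans (sym (Fin.finToFun-funToFin f i))
    (trans (cong (λ k → finToFun k i) eq) (Fin.finToFun-funToFin g i))

  record Enumeration (P : Fin n → Set p) : Set p where
    field
      size      : ℕ
      index     : Fin size → Fin n
      injective : ∀ {i j} → index i ≡ index j → i ≡ j
      sound     : ∀ i → P (index i)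
      complete  : ∀ {k} → P k → ∃ λ i → index i ≡ k

  enumerate : {P : Fin n → Set p} → (∀ i → Dec (P i)) → Enumeration P
  enumerate {zero}  P? = record
    { size = 0 ; index = λ () ; injective = λ { {()} } ; sound = λ () ; complete = λ { {()} } }
  enumerate {suc n} {P = P} P? with P? zero | enumerate (P? ∘ suc)
  ... | no ¬P0 | E = record
    { size      = E.size
    ; index     = suc ∘ E.index
    ; injective = E.injective ∘ Fin.suc-injective
    ; sound     = E.sound
    ; complete  = λ { {zero} P0 → contradiction P0 ¬P0
                    ; {suc k} Pk → let i , eq = E.complete Pk in i , cong suc eq }
    } where module E = Enumeration E
  ... | yes P0 | E = record
    { size      = suc E.size
    ; index     = λ { zero → zero ; (suc i) → suc (E.index i) }
    ; injective = λ { {zero} {zero} _ → refl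
                    ; {suc i} {suc j} eq → cong suc (E.injective (Fin.suc-injective eq)) }
    ; sound     = λ { zero → P0 ; (suc i) → E.sound i }
    ; complete  = λ { {zero} _ → zero , refl
                    ; {suc k} Pk → let i , eq = E.complete Pk in suc i , cong suc eq }
    } where module E = Enumeration E

open Combinatorics

-- Initial topologies, connectedness and components.

module LayerTheory where

  open ≡ using (refl; sym; trans; cong; cong₂; module ≡-Reasoning)
  open CommutativeMonoidSum ℤ.+-0-commutativeMonoid using (sum; sum-cong-≗)

  private variable
    o o′ s : Level
    R S : Setoid 0ℓ 0ℓ

  -- The open sets of Defs.initial, in terms of only the data they depend on,
  -- so that unification can recover these data from an open set.
  module _ {A I : Set} {C : I → Set} (O : ∀ i → Pred (Pred (C i) 0ℓ) o) (f : ∀ i → A → C i) where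

    private
      Condition : Set₁
      Condition = Σ I λ i → Pred (C i) 0ℓ

    InitialOpen : Pred A 0ℓ → Set (Level.suc 0ℓ ⊔ o)
    InitialOpen V = ∀ x → x ∈ V → ∃ λ (cs : List Condition) →
      All (λ (i , W) → O i W) cs × All (λ (i , W) → W (f i x)) cs ×
      (∀ y → All (λ (i , W) → W (f i y)) cs → y ∈ V)

    initial-projection : ∀ i W → O i W → InitialOpen (W ∘ f i)
    initial-projection i W W-open x fx∈W =
      (i , W) ∷ [] , W-open ∷ [] , fx∈W ∷ [] , λ { _ (fy∈W ∷ []) → fy∈W }

    -- Each point of the preimage of `V` has around it a finite intersection of open preimages that
    -- stays inside, and the preimage is the union of these over its own points.
    initial-universal : (σ : Topology R o′) (h : Setoid.Carrier R → A) →
      (∀ i W → O i W → Open σ (W ∘ f i ∘ h)) → ∀ V → InitialOpen V → Open σ (V ∘ h)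
    initial-universal {R = R} σ h fh-continuous V V-open =
      Topology.Open-resp-≐ σ (⋃⊆V , V⊆⋃)
        (Topology.Open-⋃ σ _ _ λ (r , hr∈V) → satisfy-open (proj₁ (proj₂ (V-open (h r) hr∈V))))
      where
      -- All (…) lives one universe too high to be a subset here.
      Satisfy : List Condition → Pred (Setoid.Carrier R) 0ℓ
      Satisfy []             r = ⊤
      Satisfy ((i , W) ∷ cs) r = W (f i (h r)) × Satisfy cs r

      satisfy-open : ∀ {cs} → All (λ (i , W) → O i W) cs → Open σ (Satisfy cs)
      satisfy-open []                           = Topology.Open-U σ
      satisfy-open (_∷_ {i , W} W-open cs-open) =
        Topology.Open-∩ σ (fh-continuous i W W-open) (satisfy-open cs-open)

      fromAll : ∀ {cs r} → All (λ (i , W) → W (f i (h r))) cs → Satisfy cs r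
      fromAll []       = tt
      fromAll (w ∷ ws) = w , fromAll ws

      toAll : ∀ cs {r} → Satisfy cs r → All (λ (i , W) → W (f i (h r))) cs
      toAll []       _        = []
      toAll (_ ∷ cs) (w , ws) = w ∷ toAll cs ws

      piece : Σ (Setoid.Carrier R) (V ∘ h) → Pred (Setoid.Carrier R) 0ℓ
      piece (r , hr∈V) = Satisfy (proj₁ (V-open (h r) hr∈V))

      ⋃⊆V : ⋃ _ piece ⊆ V ∘ h
      ⋃⊆V {r′} ((r , hr∈V) , r′∈) = let cs , _ , _ , cs⊆V = V-open (h r) hr∈V
                                    in cs⊆V (h r′) (toAll cs r′∈)

      V⊆⋃ : V ∘ h ⊆ ⋃ _ piece
      V⊆⋃ {r} hr∈V = (r , hr∈V) , fromAll (proj₁ (proj₂ (proj₂ (V-open (h r) hr∈V))))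

  module _ (τ : Topology S o) where

    open Setoid S using (Carrier)

    connected-∪ : {X Y : Pred Carrier 0ℓ} →
      Connected τ X → Connected τ Y → X ≬ Y → Connected τ (X ∪ Y)
    connected-∪ {X} {Y} (_ , splitX) (_ , splitY) (p , p∈X , p∈Y) =
      (p , inj₁ p∈X) , split
      where
      split : ∀ V W → Open τ V → Open τ W → X ∪ Y ⊆ V ∪ W →
              X ∪ Y ≬ V → X ∪ Y ≬ W → X ∪ Y ≬ (V ∩ W)
      inX : ∀ V W → Open τ V → Open τ W → X ∪ Y ⊆ V ∪ W → X ≬ V → X ≬ W → X ∪ Y ≬ (V ∩ W)
      inX V W oV oW c v w = let x , x∈X , x∈VW = splitX V W oV oW (c ∘ inj₁) v w
                            in x , inj₁ x∈X , x∈VW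
      inY : ∀ V W → Open τ V → Open τ W → X ∪ Y ⊆ V ∪ W → Y ≬ V → Y ≬ W → X ∪ Y ≬ (V ∩ W)
      inY V W oV oW c v w = let x , x∈Y , x∈VW = splitY V W oV oW (c ∘ inj₂) v w
                            in x , inj₂ x∈Y , x∈VW
      split V W oV oW c (v , inj₁ v∈X , v∈V) (w , inj₁ w∈X , w∈W) =
        inX V W oV oW c (v , v∈X , v∈V) (w , w∈X , w∈W)
      split V W oV oW c (v , inj₂ v∈Y , v∈V) (w , inj₂ w∈Y , w∈W) =
        inY V W oV oW c (v , v∈Y , v∈V) (w , w∈Y , w∈W)
      -- The witnesses lie in different parts. The common point `p` is in `V` or in `W` and replaces
      -- the corresponding witness, which brings both into one part.
      split V W oV oW c (v , inj₁ v∈X , v∈V) (w , inj₂ w∈Y , w∈W) with c (inj₁ p∈X)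
      ... | inj₁ p∈V = inY V W oV oW c (p , p∈Y , p∈V) (w , w∈Y , w∈W)
      ... | inj₂ p∈W = inX V W oV oW c (v , v∈X , v∈V) (p , p∈X , p∈W)
      split V W oV oW c (v , inj₂ v∈Y , v∈V) (w , inj₁ w∈X , w∈W) with c (inj₁ p∈X)
      ... | inj₁ p∈V = inX V W oV oW c (p , p∈X , p∈V) (w , w∈X , w∈W)
      ... | inj₂ p∈W = inY V W oV oW c (v , v∈Y , v∈V) (p , p∈Y , p∈W)

    -- Maximality of the component, applied to the connected set `X ∪ Y`. Most later inclusions
    -- between layers, members and lines come from here.
    component-absorbs : {X Y : Pred Carrier 0ℓ} {Z : Pred Carrier s} →
      _IsComponentOf_ τ X Z → Connected τ Y → Y ⊆ Z → X ≬ Y → Y ⊆ X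
    component-absorbs (X-conn , X⊆Z , X-max) Y-conn Y⊆Z X≬Y y∈Y =
      X-max _ (connected-∪ X-conn Y-conn X≬Y)
        (λ { (inj₁ x∈X) → X⊆Z x∈X ; (inj₂ y∈Y) → Y⊆Z y∈Y }) inj₁ (inj₂ y∈Y)

  module _ (lem : ∀ {ℓ} → ExcludedMiddle ℓ) where

    -- Propositional resizing, by excluded middle.
    record ⌈_⌉ {p} (P : Set p) : Set where
      constructor resized
      field holds : True (lem {P = P})

    ⌈⌉⁺ : ∀ {p} {P : Set p} → P → ⌈ P ⌉
    ⌈⌉⁺ x = resized (fromWitness x)

    ⌈⌉⁻ : ∀ {p} {P : Set p} → ⌈ P ⌉ → P
    ⌈⌉⁻ (resized x) = toWitness x

    -- The component is the union of all connected subsets of `Z` containing `X`. It quantifies over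
    -- subsets, so `⌈_⌉` is needed to make it a subset again. It is connected because all the pieces
    -- share the point `p`.
    component-exists : (τ : Topology S o) {X : Pred (Setoid.Carrier S) 0ℓ}
      {Z : Pred (Setoid.Carrier S) s} → Connected τ X → X ⊆ Z →
      ∃ λ C → _IsComponentOf_ τ C Z × X ⊆ C
    component-exists {S = S} τ {X} {Z} X-conn@((p , p∈X) , _) X⊆Z =
      C , (((p , X⊆C p∈X) , split) , C⊆Z , λ D D-conn D⊆Z C⊆D y∈D →
            ⊆C D-conn D⊆Z (C⊆D ∘ X⊆C) y∈D) , X⊆C
      where
      C : Pred (Setoid.Carrier S) 0ℓ
      C y = ⌈ (∃ λ D → Connected τ D × D ⊆ Z × X ⊆ D × y ∈ D) ⌉

      ⊆C : ∀ {D} → Connected τ D → D ⊆ Z → X ⊆ D → D ⊆ C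
      ⊆C {D} D-conn D⊆Z X⊆D y∈D = ⌈⌉⁺ (D , D-conn , D⊆Z , X⊆D , y∈D)

      X⊆C : X ⊆ C
      X⊆C = ⊆C X-conn X⊆Z id

      C⊆Z : C ⊆ Z
      C⊆Z y∈C = let _ , _ , D⊆Z , _ , y∈D = ⌈⌉⁻ y∈C in D⊆Z y∈D

      split : ∀ V W → Open τ V → Open τ W → C ⊆ V ∪ W → C ≬ V → C ≬ W → C ≬ (V ∩ W)
      split V W oV oW c (v , v∈C , v∈V) (w , w∈C , w∈W)
        with ⌈⌉⁻ v∈C | ⌈⌉⁻ w∈C | c (X⊆C p∈X)
      ... | _ | D , D-conn , D⊆Z , X⊆D , w∈D | inj₁ p∈V =
        let D⊆C = λ {y} → ⊆C D-conn D⊆Z X⊆D {y}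
            x , x∈D , x∈VW = proj₂ D-conn V W oV oW (c ∘ D⊆C) (p , X⊆D p∈X , p∈V) (w , w∈D , w∈W)
        in x , D⊆C x∈D , x∈VW
      ... | D , D-conn , D⊆Z , X⊆D , v∈D | _ | inj₂ p∈W =
        let D⊆C = λ {y} → ⊆C D-conn D⊆Z X⊆D {y}
            x , x∈D , x∈VW = proj₂ D-conn V W oV oW (c ∘ D⊆C) (v , v∈D , v∈V) (p , X⊆D p∈X , p∈W)
        in x , D⊆C x∈D , x∈VW

    module LayerProperties (ℝ : Reals) {S : Setoid 0ℓ 0ℓ} (τ : Topology S 1ℓ) where

      open Layers lem ℝ τ
      open Setoid S using (Carrier)

      subspace-inclusion : {X Y : Subset} (X⊆Y : X ⊆ Y) →
        Continuous (subspace τ X) (subspace τ Y) (λ (x , x∈X) → x , X⊆Y x∈X)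
      subspace-inclusion {X} X⊆Y =
        initial-universal _ _ (subspace τ X) _ λ _ W W-open → initial-projection _ _ tt W W-open

      -- Points of a subspace are compared by their underlying points, so the same charts serve and
      -- only the membership proofs change.
      hasDimension-resp-≐ : ∀ {X Y d} → X ≐ Y → HasDimension ℝ τ X d → HasDimension ℝ τ Y d
      hasDimension-resp-≐ {X} {Y} {d} (X⊆Y , Y⊆X) X-dim y y∈Y =
        let V , V-open , y∈V , h = X-dim y (Y⊆X y∈Y)
        in V , V-open , y∈V , transfer V h
        where
        transfer : ∀ V → Homeomorphism (subspace τ (X ∩ V)) (ℝ^-topology ℝ d) →
                   Homeomorphism (subspace τ (Y ∩ V)) (ℝ^-topology ℝ d)
        transfer V h = record
          { inverse = record
            { to        = h.to ∘ in⁻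
            ; from      = in⁺ ∘ h.from
            ; to-cong   = h.to-cong
            ; from-cong = h.from-cong
            ; inverse   = h.inverseˡ , h.inverseʳ
            }
          ; to-continuous   = λ W W-open →
              subspace-inclusion (λ (y∈Y , y∈V) → Y⊆X y∈Y , y∈V) _ (h.to-continuous W W-open)
          ; from-continuous = λ W W-open →
              h.from-continuous _ (subspace-inclusion (λ (x∈X , x∈V) → X⊆Y x∈X , x∈V) W W-open)
          }
          where
          module h = Homeomorphism h
          in⁻ : Σ Carrier (Y ∩ V) → Σ Carrier (X ∩ V)
          in⁻ (y , y∈Y , y∈V) = y , Y⊆X y∈Y , y∈V
          in⁺ : Σ Carrier (X ∩ V) → Σ Carrier (Y ∩ V)
          in⁺ (x , x∈X , x∈V) = x , X⊆Y x∈X , x∈V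

      dim-cong : ∀ {X Y} → X ≐ Y → dim X ≡ dim Y
      dim-cong {X} {Y} X≐Y@(X⊆Y , Y⊆X)
        with lem {P = ∃ λ d → HasDimension ℝ τ X d × (∀ e → HasDimension ℝ τ X e → d ℕ.≤ e)}
           | lem {P = ∃ λ d → HasDimension ℝ τ Y d × (∀ e → HasDimension ℝ τ Y e → d ℕ.≤ e)}
      ... | yes (d , dX , least) | yes (e , eY , least′) = ℕ.≤-antisym
        (least e (hasDimension-resp-≐ (Y⊆X , X⊆Y) eY)) (least′ d (hasDimension-resp-≐ X≐Y dX))
      ... | no _ | no _ = refl
      ... | yes (d , dX , least) | no ¬Y = contradiction
        (d , hasDimension-resp-≐ X≐Y dX , λ e → least e ∘ hasDimension-resp-≐ (Y⊆X , X⊆Y)) ¬Y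
      ... | no ¬X | yes (d , dY , least) = contradiction
        (d , hasDimension-resp-≐ (Y⊆X , X⊆Y) dY , λ e → least e ∘ hasDimension-resp-≐ X≐Y) ¬X

      -- Layers and their finite enumeration.

      Meet : Subset → Pred Subset 0ℓ → Pred Carrier 1ℓ
      Meet W B x = x ∈ W × (∀ Y → Y ∈ B → x ∈ Y)

      -- The largest subfamily whose intersection contains `X`. A layer `X` is a component of this
      -- intersection too, whichever subfamily it came from. The resizing is forced by `Layer`,
      -- whose subfamilies live at level zero.
      Above : Family → Subset → Pred Subset 0ℓ
      Above 𝓕 X K = ⌈ (K ∈ 𝓕 × X ⊆ K) ⌉

      above⊆ : ∀ 𝓕 X → Above 𝓕 X ⊆ 𝓕
      above⊆ 𝓕 X = proj₁ ∘ ⌈⌉⁻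

      ⊆Meet-Above : ∀ {W 𝓕 X} → X ⊆ W → X ⊆ Meet W (Above 𝓕 X)
      ⊆Meet-Above X⊆W x∈X = X⊆W x∈X , λ K K∈ → proj₂ (⌈⌉⁻ K∈) x∈X

      layer-connected : ∀ {W 𝓕 X} → X ∈ Layer W 𝓕 → Connected τ X
      layer-connected (_ , _ , X-conn , _) = X-conn

      ambient-layer : ∀ {W 𝓕} → Connected τ W → W ∈ Layer W 𝓕
      ambient-layer W-conn = (λ _ → ⊥) , (λ ()) , W-conn ,
        (λ x∈W → x∈W , λ _ ()) , λ _ _ C⊆ _ → proj₁ ∘ C⊆

      module _ (n : ℕ) (type : Carrier → Fin n) where

        Saturated : Pred Subset 0ℓ
        Saturated X = ∀ {x y} → type x ≡ type y → x ∈ X → y ∈ X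

        private
          Hits : Subset → Fin n → Set
          Hits X i = ∃ λ x → x ∈ X × type x ≡ i

          code : Subset → Fin (2 ℕ.^ n)
          code X = funToFin λ i → bit (lem {P = Hits X i})

          code-cong : ∀ {X Y} → X ≐ Y → code X ≡ code Y
          code-cong (X⊆Y , Y⊆X) = funToFin-cong λ i → bit-cong (lem {P = Hits _ i}) lem
            (λ (x , x∈X , eq) → x , X⊆Y x∈X , eq) (λ (y , y∈Y , eq) → y , Y⊆X y∈Y , eq)

          code-⊆ : ∀ {X Y} → Saturated Y → code X ≡ code Y → X ⊆ Y
          code-⊆ {X} {Y} Y-sat eq {x} x∈X =
            let y , y∈Y , ty≡tx = bit-injective (lem {P = Hits X (type x)}) lem bits (x , x∈X , refl)
            in Y-sat ty≡tx y∈Y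
            where
            bits : bit (lem {P = Hits X (type x)}) ≡ bit (lem {P = Hits Y (type x)})
            bits = funToFin-injective {f = λ i → bit (lem {P = Hits X i})} eq (type x)

        -- A saturated set is a union of fibres of `type`, hence determined by the types that it
        -- hits, and these are coded by a number below `2 ^ n`. Enumerating the codes that occur
        -- lists the layers without repetition.
        layerPoset : ∀ {W 𝓕} → Connected τ W → Layer W 𝓕 ⊆ Saturated → LayerPoset W 𝓕
        layerPoset {W} {𝓕} W-conn saturated = record
          { size      = E.size
          ; layer     = layer
          ; isLayer   = isLayer
          ; distinct  = λ {i} {j} i≐j → E.injective
              (trans (sym (code-layer i)) (trans (code-cong i≐j) (code-layer j)))
          ; complete  = complete
          ; minimum   = proj₁ (complete (ambient-layer {W} {𝓕} W-conn))
          ; minimum≐W = proj₂ (complete (ambient-layer {W} {𝓕} W-conn))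
          }
          where
          Coded : Fin (2 ℕ.^ n) → Set₁
          Coded k = ∃ λ X → X ∈ Layer W 𝓕 × code X ≡ k

          module E = Enumeration (enumerate {P = Coded} λ _ → lem)

          layer : Fin E.size → Subset
          layer i = proj₁ (E.sound i)

          isLayer : ∀ i → layer i ∈ Layer W 𝓕
          isLayer i = proj₁ (proj₂ (E.sound i))

          code-layer : ∀ i → code (layer i) ≡ E.index i
          code-layer i = proj₂ (proj₂ (E.sound i))

          complete : ∀ {X} → X ∈ Layer W 𝓕 → ∃ λ i → layer i ≐ X
          complete {X} X∈ =
            let i , eq = E.complete (X , X∈ , refl)
                same = trans (code-layer i) eq
            in i , code-⊆ (saturated X∈) same , code-⊆ (saturated (isLayer i)) (sym same)

      -- Existence of one enumeration excludes the default value `0ₚ`. The enumeration that `χ`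
      -- itself uses may be a different one, so what follows must hold for arbitrary enumerations.
      χ-layerPoset : ∀ {W 𝓕} → LayerPoset W 𝓕 →
        ∃ λ (L : LayerPoset W 𝓕) → χ W 𝓕 ≡ LayerPoset.characteristicPolynomial L
      χ-layerPoset {W} {𝓕} L with lem {P = LayerPoset W 𝓕}
      ... | yes L′ = L′ , refl
      ... | no ¬L  = contradiction L ¬L

      -- Deletion and restriction for an abstract family.

      module DeletionRestriction
        {𝓕 : Family} {H : Subset} (H∈𝓕 : H ∈ 𝓕)
        (U-connected : Connected τ U)
        (H-connected : Connected τ H)
        (proper      : ∀ {K} → K ∈ 𝓕 → ¬ U ⊆ K)
        (antichain   : ∀ {K} → K ∈ 𝓕 → H ⊆ K → K ⊆ H)
        where

        𝓕′ 𝓕″ : Family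
        𝓕′ = deletion 𝓕 H
        𝓕″ = restriction 𝓕 H

        deletion-layer : Layer U 𝓕′ ⊆ Layer U 𝓕
        deletion-layer (B , B⊆ , X-comp) = B , proj₁ ∘ B⊆ , X-comp

        restriction-layer : Layer H 𝓕″ ⊆ Layer U 𝓕
        restriction-layer {X} (B , B⊆ , X-conn@((p , p∈X) , _) , X⊆Meet , X-max) =
          Above 𝓕 X , above⊆ 𝓕 X , X-conn , ⊆Meet-Above {𝓕 = 𝓕} _ , maximal
          where
          maximal : ∀ C → Connected τ C → C ⊆ Meet U (Above 𝓕 X) → X ⊆ C → C ⊆ X
          maximal C C-conn C⊆ X⊆C = X-max C C-conn (λ c∈C → C⊆H c∈C , λ M M∈B → C⊆M M∈B c∈C) X⊆C
            where
            C⊆H : C ⊆ H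
            C⊆H c∈C = proj₂ (C⊆ c∈C) H (⌈⌉⁺ (H∈𝓕 , λ x∈X → proj₁ (X⊆Meet x∈X)))

            C⊆M : ∀ {M} → M ∈ B → C ⊆ M
            C⊆M {M} M∈B =
              let K , (K∈𝓕 , _) , M-comp@(_ , M⊆K∩H , _) = B⊆ M∈B
                  X⊆M = λ {x} (x∈X : x ∈ X) → proj₂ (X⊆Meet x∈X) M M∈B
              in component-absorbs τ M-comp C-conn
                   (λ c∈C → proj₂ (C⊆ c∈C) K (⌈⌉⁺ (K∈𝓕 , λ x∈X → proj₁ (M⊆K∩H (X⊆M x∈X)))) , C⊆H c∈C)
                   (p , X⊆M p∈X , X⊆C p∈X)

        -- Each `K` in `B` other than `H` is replaced by the component of `K ∩ H` that contains `X`;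
        -- this is a member of `𝓕″` and forces points into `K`.
        layer⇒restriction-layer : ∀ {X} → X ∈ Layer U 𝓕 → X ⊆ H → X ∈ Layer H 𝓕″
        layer⇒restriction-layer {X} (B , B⊆ , X-conn , X⊆Meet , X-max) X⊆H =
          Above 𝓕″ X , above⊆ 𝓕″ X , X-conn , ⊆Meet-Above {𝓕 = 𝓕″} X⊆H , maximal
          where
          maximal : ∀ C → Connected τ C → C ⊆ Meet H (Above 𝓕″ X) → X ⊆ C → C ⊆ X
          maximal C C-conn C⊆ X⊆C = X-max C C-conn (λ c∈C → tt , λ K K∈B → C⊆K K∈B c∈C) X⊆C
            where
            C⊆K : ∀ {K} → K ∈ B → C ⊆ K
            C⊆K {K} K∈B c∈C with lem {P = K ≐ H}
            ... | yes (_ , H⊆K) = H⊆K (proj₁ (C⊆ c∈C))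
            ... | no K≭H =
              let M , M-comp@(_ , M⊆K∩H , _) , X⊆M =
                    component-exists τ {Z = K ∩ H} X-conn
                      (λ x∈X → proj₂ (X⊆Meet x∈X) K K∈B , X⊆H x∈X)
              in proj₁ (M⊆K∩H (proj₂ (C⊆ c∈C) M
                   (⌈⌉⁺ ((K , (B⊆ K∈B , K≭H) , M-comp) , X⊆M))))

        module _ {X} (X∈ : X ∈ Layer U 𝓕) where

          private
            X-conn : Connected τ X
            X-conn = layer-connected {𝓕 = 𝓕} X∈

            found = component-exists τ {Z = Meet U (Above 𝓕′ X)} X-conn (⊆Meet-Above {𝓕 = 𝓕′} _)

          -- The smallest layer of `𝓕′` containing `X`, by `hull-layer`, `⊆hull` and `hull-least`.
          hull : Subset
          hull = proj₁ found

          hull-component : _IsComponentOf_ τ hull (Meet U (Above 𝓕′ X))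
          hull-component = proj₁ (proj₂ found)

          ⊆hull : X ⊆ hull
          ⊆hull = proj₂ (proj₂ found)

          hull-layer : hull ∈ Layer U 𝓕′
          hull-layer = Above 𝓕′ X , above⊆ 𝓕′ X , hull-component

          hull⊆K : ∀ {K} → K ∈ 𝓕′ → X ⊆ K → hull ⊆ K
          hull⊆K K∈ X⊆K h∈ = proj₂ (proj₁ (proj₂ hull-component) h∈) _ (⌈⌉⁺ (K∈ , X⊆K))

          hull-least : ∀ {Z} → Z ∈ Layer U 𝓕′ → X ⊆ Z → hull ⊆ Z
          hull-least (B , B⊆ , Z-comp@(_ , Z⊆Meet , _)) X⊆Z =
            let p , p∈X = proj₁ X-conn in
            component-absorbs τ Z-comp (proj₁ hull-component)
              (λ h∈ → tt , λ K K∈B → hull⊆K (B⊆ K∈B) (λ x∈X → proj₂ (Z⊆Meet (X⊆Z x∈X)) K K∈B) h∈)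
              (p , X⊆Z p∈X , ⊆hull p∈X)

          -- By `antichain` a member containing `H` equals `H` and has been deleted. So the
          -- intersection defining the hull is empty, and its component is the whole connected
          -- space.
          hull-of-H : H ⊆ X → U ⊆ hull
          hull-of-H H⊆X = proj₂ (proj₂ hull-component) U U-connected
            (λ _ → tt , λ K K∈ → ⊥-elim (excluded K∈)) _
            where
            excluded : ∀ {K} → ¬ K ∈ Above 𝓕′ X
            excluded K∈ with ⌈⌉⁻ K∈
            ... | (K∈𝓕 , K≭H) , X⊆K = K≭H (antichain K∈𝓕 (X⊆K ∘ H⊆X) , X⊆K ∘ H⊆X)

        -- A member of `𝓕′` above `X` would contain the hull, hence everything, against `proper`. So
        -- `X` is cut out by `H` alone, or by nothing, and the latter would make `X` the whole
        -- space.
        hull-full : ∀ {X} (X∈ : X ∈ Layer U 𝓕) → U ⊆ hull X∈ → ¬ U ⊆ X → X ≐ H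
        hull-full {X} X∈@(B , B⊆ , _ , X⊆Meet , X-max) U⊆hull U⊈X = X⊆H , H⊆X
          where
          only-H : ∀ {K} → K ∈ B → K ≐ H
          only-H {K} K∈B with lem {P = K ≐ H}
          ... | yes K≐H = K≐H
          ... | no K≭H  = contradiction
            (λ {x} (x∈U : x ∈ U) →
              hull⊆K X∈ (B⊆ K∈B , K≭H) (λ x∈X → proj₂ (X⊆Meet x∈X) K K∈B) (U⊆hull x∈U))
            (proper (B⊆ K∈B))

          X⊆H : X ⊆ H
          X⊆H {x} x∈X with lem {P = x ∈ H}
          ... | yes x∈H = x∈H
          ... | no x∉H  = contradiction
            (λ {y} → X-max U U-connected
              (λ _ → tt , λ K K∈B → contradiction (proj₁ (only-H K∈B) (proj₂ (X⊆Meet x∈X) K K∈B)) x∉H)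
              _ {y})
            U⊈X

          H⊆X : H ⊆ X
          H⊆X = X-max H H-connected (λ h∈H → tt , λ K K∈B → proj₂ (only-H K∈B) h∈H) X⊆H

        module _ (L : LayerPoset U 𝓕) (L′ : LayerPoset U 𝓕′) (L″ : LayerPoset H 𝓕″) where

          private
            module L where
              open LayerPoset L public
              open MöbiusProperties ⊑-isPartialOrder (λ _ _ → lem) public
                using (sum-μ; sum-⊑-injective)
            module L′ where
              open LayerPoset L′ public
              open MöbiusProperties ⊑-isPartialOrder (λ _ _ → lem) public using (sum-μ)
            module L″ where
              open LayerPoset L″ public
              open MöbiusProperties ⊑-isPartialOrder (λ _ _ → lem) public using (sum-μ)

            e′ : Fin L′.size → Fin L.size
            e′ j = proj₁ (L.complete (deletion-layer (L′.isLayer j)))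

            e′-layer : ∀ j → L.layer (e′ j) ≐ L′.layer j
            e′-layer j = proj₂ (L.complete (deletion-layer (L′.isLayer j)))

            e″ : Fin L″.size → Fin L.size
            e″ j = proj₁ (L.complete (restriction-layer (L″.isLayer j)))

            e″-layer : ∀ j → L.layer (e″ j) ≐ L″.layer j
            e″-layer j = proj₂ (L.complete (restriction-layer (L″.isLayer j)))

            μ′ : Fin L′.size → ℤ
            μ′ = L′.μ L′.minimum

            μ″ : Fin L″.size → ℤ
            μ″ = L″.μ L″.minimum

            difference : Fin L.size → ℤ
            difference i = pushforward e′ μ′ i ℤ.- pushforward e″ μ″ i

            sum-difference : ∀ {p} {P : Fin L.size → Set p} (P? : ∀ i → Dec (P i)) →
              sum (λ i → when (P? i) (difference i)) ≡
              sum (λ j → when (P? (e′ j)) (μ′ j)) ℤ.- sum (λ j → when (P? (e″ j)) (μ″ j))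
            sum-difference P? = trans
              (sum-when-difference P? (pushforward e′ μ′) (pushforward e″ μ″))
              (cong₂ ℤ._-_ (sum-pushforward P? e′ μ′) (sum-pushforward P? e″ μ″))

            -- Being the minimum is tested on the subset itself, a condition that can be compared
            -- between the different enumerations.
            full? : (X : Subset) → Dec (U ⊆ X)
            full? X = lem

            sum-μ-full : ∀ y → sum (λ z → when (lem {P = z L.⊑ y}) (L.μ L.minimum z)) ≡
                               when (full? (L.layer y)) 1ℤ
            sum-μ-full y = trans
              (L.sum-μ L.minimum (λ _ _ → proj₂ L.minimum≐W _) y)
              (when-⇔ (L.minimum Fin.≟ y) (full? (L.layer y))
                (λ { refl → proj₂ L.minimum≐W })
                (λ U⊆y → L.distinct ((λ _ → U⊆y _) , λ _ → proj₂ L.minimum≐W _)) 1ℤ)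

            -- A layer of `𝓕′` contains the layer `y` exactly when it contains its hull, so this is
            -- the Möbius sum of `L′` at the hull.
            sum-μ′ : ∀ y → sum (λ j → when (lem {P = e′ j L.⊑ y}) (μ′ j)) ≡
                           when (full? (hull (L.isLayer y))) 1ℤ
            sum-μ′ y = begin
              sum (λ j → when (lem {P = e′ j L.⊑ y}) (μ′ j))
                ≡⟨ sum-cong-≗ (λ j → when-⇔ lem lem (below j) (above j) (μ′ j)) ⟩
              sum (λ j → when (lem {P = j L′.⊑ y′}) (μ′ j))
                ≡⟨ L′.sum-μ L′.minimum (λ _ _ → proj₂ L′.minimum≐W _) y′ ⟩
              when (L′.minimum Fin.≟ y′) 1ℤ
                ≡⟨ when-⇔ (L′.minimum Fin.≟ y′) (full? (hull X∈))
                     (λ { refl _ → proj₁ y′-hull (proj₂ L′.minimum≐W _) })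
                     (λ U⊆hull → L′.distinct
                       ((λ _ → proj₂ y′-hull (U⊆hull _)) , λ _ → proj₂ L′.minimum≐W _)) 1ℤ ⟩
              when (full? (hull X∈)) 1ℤ ∎
              where
              open ≡-Reasoning
              X∈ = L.isLayer y
              y′ = proj₁ (L′.complete (hull-layer X∈))
              y′-hull = proj₂ (L′.complete (hull-layer X∈))
              below : ∀ j → e′ j L.⊑ y → j L′.⊑ y′
              below j y⊆e′j = hull-least X∈ (L′.isLayer j) (proj₁ (e′-layer j) ∘ y⊆e′j) ∘ proj₁ y′-hull
              above : ∀ j → j L′.⊑ y′ → e′ j L.⊑ y
              above j y′⊆j = proj₂ (e′-layer j) ∘ y′⊆j ∘ proj₂ y′-hull ∘ ⊆hull X∈

            ⊆H : ∀ j → L″.layer j ⊆ H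
            ⊆H j = let _ , _ , _ , j⊆ , _ = L″.isLayer j in proj₁ ∘ j⊆

            -- A layer outside `H` is contained in no layer of `𝓕″`, and both sides vanish. A layer
            -- inside `H` is itself a layer of `𝓕″`, and the Möbius sum of `L″` applies.
            sum-μ″ : ∀ y → sum (λ j → when (lem {P = e″ j L.⊑ y}) (μ″ j)) ≡
                           when (lem {P = L.layer y ≐ H}) 1ℤ
            sum-μ″ y with lem {P = L.layer y ⊆ H}
            ... | no y⊈H = trans
              (sum-zero λ j → when-no (lem {P = e″ j L.⊑ y})
                (λ y⊆e″j → y⊈H (λ x∈y → ⊆H j (proj₁ (e″-layer j) (y⊆e″j x∈y)))) (μ″ j))
              (sym (when-no (lem {P = L.layer y ≐ H}) (y⊈H ∘ proj₁) 1ℤ))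
            ... | yes y⊆H = begin
              sum (λ j → when (lem {P = e″ j L.⊑ y}) (μ″ j))
                ≡⟨ sum-cong-≗ (λ j → when-⇔ lem lem (below j) (above j) (μ″ j)) ⟩
              sum (λ j → when (lem {P = j L″.⊑ y″}) (μ″ j))
                ≡⟨ L″.sum-μ L″.minimum (λ j → proj₂ L″.minimum≐W ∘ ⊆H j) y″ ⟩
              when (L″.minimum Fin.≟ y″) 1ℤ
                ≡⟨ when-⇔ (L″.minimum Fin.≟ y″) (lem {P = L.layer y ≐ H})
                     (λ { refl → y⊆H , proj₁ y″-layer ∘ proj₂ L″.minimum≐W })
                     (λ (_ , H⊆y) → L″.distinct
                       (proj₂ y″-layer ∘ H⊆y ∘ ⊆H _ , proj₂ L″.minimum≐W ∘ ⊆H _)) 1ℤ ⟩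
              when (lem {P = L.layer y ≐ H}) 1ℤ ∎
              where
              open ≡-Reasoning
              X∈″ = layer⇒restriction-layer (L.isLayer y) y⊆H
              y″ = proj₁ (L″.complete X∈″)
              y″-layer = proj₂ (L″.complete X∈″)
              below : ∀ j → e″ j L.⊑ y → j L″.⊑ y″
              below j y⊆e″j = proj₁ (e″-layer j) ∘ y⊆e″j ∘ proj₁ y″-layer
              above : ∀ j → j L″.⊑ y″ → e″ j L.⊑ y
              above j y″⊆j = proj₂ (e″-layer j) ∘ y″⊆j ∘ proj₂ y″-layer

            -- The hull is full exactly when `X` is full or equal to `H`, and these two cases
            -- exclude each other because `H` is proper.
            indicators : ∀ {X} (X∈ : X ∈ Layer U 𝓕)
              (h? : Dec (U ⊆ hull X∈)) (H? : Dec (X ≐ H)) (U? : Dec (U ⊆ X)) →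
              when h? 1ℤ ℤ.- when H? 1ℤ ≡ when U? 1ℤ
            indicators X∈ _       (yes X≐H) (yes U⊆X) =
              contradiction (λ {x} u → proj₁ X≐H (U⊆X {x} u)) (proper H∈𝓕)
            indicators X∈ (yes _) (no _)    (yes _)   = refl
            indicators X∈ (no U⊈h) (no _)   (yes U⊆X) =
              contradiction (λ {x} u → ⊆hull X∈ (U⊆X {x} u)) U⊈h
            indicators X∈ (yes _) (yes _)   (no _)    = refl
            indicators X∈ (no U⊈h) (yes X≐H) (no _)   =
              contradiction (λ {x} → hull-of-H X∈ (proj₂ X≐H) {x}) U⊈h
            indicators X∈ (yes U⊆h) (no X≭H) (no U⊈X) = contradiction (hull-full X∈ U⊆h U⊈X) X≭H
            indicators X∈ (no _)  (no _)    (no _)    = refl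

            μ-difference : ∀ i → L.μ L.minimum i ≡ difference i
            μ-difference = L.sum-⊑-injective {L.μ L.minimum} {difference} λ y → begin
              sum (λ z → when (lem {P = z L.⊑ y}) (L.μ L.minimum z))
                ≡⟨ sum-μ-full y ⟩
              when (full? (L.layer y)) 1ℤ
                ≡⟨ indicators (L.isLayer y) (full? (hull (L.isLayer y)))
                   (lem {P = L.layer y ≐ H}) (full? (L.layer y)) ⟨
              when (full? (hull (L.isLayer y))) 1ℤ ℤ.- when (lem {P = L.layer y ≐ H}) 1ℤ
                ≡⟨ cong₂ ℤ._-_ (sum-μ′ y) (sum-μ″ y) ⟨
              sum (λ j → when (lem {P = e′ j L.⊑ y}) (μ′ j)) ℤ.-
              sum (λ j → when (lem {P = e″ j L.⊑ y}) (μ″ j))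
                ≡⟨ sum-difference (λ z → lem {P = z L.⊑ y}) ⟨
              sum (λ z → when (lem {P = z L.⊑ y}) (difference z)) ∎
              where open ≡-Reasoning

          deletion-restriction : L.characteristicPolynomial ≈ₚ
            L′.characteristicPolynomial -ₚ L″.characteristicPolynomial
          deletion-restriction k = begin
            coeff L.characteristicPolynomial k
              ≡⟨ coeff-sum-monomials (L.μ L.minimum) (dim ∘ L.layer) k ⟩
            sum (λ i → when (k ℕ.≟ dim (L.layer i)) (L.μ L.minimum i))
              ≡⟨ sum-cong-≗ (λ i → cong (when (k ℕ.≟ dim (L.layer i))) (μ-difference i)) ⟩
            sum (λ i → when (k ℕ.≟ dim (L.layer i)) (difference i))
              ≡⟨ sum-difference (λ i → k ℕ.≟ dim (L.layer i)) ⟩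
            sum (λ j → when (k ℕ.≟ dim (L.layer (e′ j))) (μ′ j)) ℤ.-
            sum (λ j → when (k ℕ.≟ dim (L.layer (e″ j))) (μ″ j))
              -- Corresponding layers are equal as subsets, which is all that has to be known about
              -- their dimensions.
              ≡⟨ cong₂ ℤ._-_
                   (sum-cong-≗ λ j → cong (λ d → when (k ℕ.≟ d) (μ′ j)) (dim-cong (e′-layer j)))
                   (sum-cong-≗ λ j → cong (λ d → when (k ℕ.≟ d) (μ″ j)) (dim-cong (e″-layer j))) ⟩
            sum (λ j → when (k ℕ.≟ dim (L′.layer j)) (μ′ j)) ℤ.-
            sum (λ j → when (k ℕ.≟ dim (L″.layer j)) (μ″ j))
              ≡⟨ cong₂ ℤ._-_ (coeff-sum-monomials μ′ (dim ∘ L′.layer) k)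
                             (coeff-sum-monomials μ″ (dim ∘ L″.layer) k) ⟨
            coeff (L′.characteristicPolynomial -ₚ L″.characteristicPolynomial) k ∎
            where open ≡-Reasoning

        -- One `type` serves all three families, since the layers of the deletion and of the
        -- restriction are among those of `𝓕`.
        χ-deletion-restriction : ∀ {n} (type : Carrier → Fin n) →
          (∀ {X} → X ∈ Layer U 𝓕 → ∀ {x y} → type x ≡ type y → x ∈ X → y ∈ X) →
          χ U 𝓕 ≈ₚ χ U 𝓕′ -ₚ χ H 𝓕″
        χ-deletion-restriction type saturated k
          with L , eq ← χ-layerPoset {𝓕 = 𝓕} (layerPoset _ type U-connected saturated)
             | L′ , eq′ ← χ-layerPoset {𝓕 = 𝓕′} (layerPoset _ type U-connected (saturated ∘ deletion-layer))
             | L″ , eq″ ← χ-layerPoset {𝓕 = 𝓕″} (layerPoset _ type H-connected (saturated ∘ restriction-layer))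
          rewrite eq | eq′ | eq″ = deletion-restriction L L′ L″ k

open LayerTheory

-- The integers inside a commutative ring.

module IntegerEmbedding {c ℓ} (R : CommutativeRing c ℓ) where

  open CommutativeRing R
  open AbelianGroupProperties +-abelianGroup using (⁻¹-∙-comm; ⁻¹-involutive; ε⁻¹≈ε)
  open RingProperties ring using (-‿distribˡ-*)
  open SemiringMult semiring using (×-homo-+) renaming (_×_ to _·_)
  open ≈-Reasoning setoid

  -- On naturals these are literally the multiples of `1#` by which the equality of the circle is
  -- defined.
  ι : ℤ → Carrier
  ι (+ n)    = n · 1#
  ι -[1+ n ] = - (suc n · 1#)

  ι-cong : ∀ {i j} → i ≡ j → ι i ≈ ι j
  ι-cong ≡.refl = refl

  ι-1 : ι 1ℤ ≈ 1#
  ι-1 = +-identityʳ 1#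

  ι-neg : ∀ i → ι (ℤ.- i) ≈ - ι i
  ι-neg -[1+ n ]    = sym (⁻¹-involutive _)
  ι-neg (+ zero)    = sym ε⁻¹≈ε
  ι-neg (+ (suc n)) = refl

  ι-⊖ : ∀ m n → ι (m ⊖ n) ≈ m · 1# - n · 1#
  ι-⊖ m       zero    = sym (trans (+-congˡ ε⁻¹≈ε) (+-identityʳ _))
  ι-⊖ zero    (suc n) = sym (+-identityˡ _)
  ι-⊖ (suc m) (suc n) = begin
    ι (suc m ⊖ suc n)                  ≈⟨ ι-cong (ℤ.[1+m]⊖[1+n]≡m⊖n m n) ⟩
    ι (m ⊖ n)                          ≈⟨ ι-⊖ m n ⟩
    m · 1# - n · 1#                    ≈⟨ +-congʳ (+-identityʳ _) ⟨
    m · 1# + 0# - n · 1#               ≈⟨ +-congʳ (+-congˡ (-‿inverseʳ 1#)) ⟨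
    m · 1# + (1# - 1#) - n · 1#        ≈⟨ +-congʳ (+-assoc _ _ _) ⟨
    m · 1# + 1# - 1# - n · 1#          ≈⟨ +-assoc _ _ _ ⟩
    m · 1# + 1# + (- 1# - n · 1#)      ≈⟨ +-cong (+-comm _ _) (⁻¹-∙-comm _ _) ⟩
    suc m · 1# - suc n · 1#            ∎

  ι-+ : ∀ i j → ι (i ℤ.+ j) ≈ ι i + ι j
  ι-+ (+ m)    (+ n)    = ×-homo-+ 1# m n
  ι-+ (+ m)    -[1+ n ] = ι-⊖ m (suc n)
  ι-+ -[1+ m ] (+ n)    = trans (ι-⊖ n (suc m)) (+-comm _ _)
  ι-+ -[1+ m ] -[1+ n ] = begin
    - (suc (suc (m ℕ.+ n)) · 1#)     ≈⟨ -‿cong (ι-cong (≡.cong (λ k → + suc k) (ℕ.+-suc m n))) ⟨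
    - ((suc m ℕ.+ suc n) · 1#)       ≈⟨ -‿cong (×-homo-+ 1# (suc m) (suc n)) ⟩
    - (suc m · 1# + suc n · 1#)      ≈⟨ ⁻¹-∙-comm _ _ ⟨
    - (suc m · 1#) - suc n · 1#      ∎

  private
    ι-pos-* : ∀ m j → ι (+ m ℤ.* j) ≈ m · 1# * ι j
    ι-pos-* zero    j = trans (ι-cong (ℤ.*-zeroˡ j)) (sym (zeroˡ _))
    ι-pos-* (suc m) j = begin
      ι (+ suc m ℤ.* j)         ≈⟨ ι-cong (ℤ.suc-* (+ m) j) ⟩
      ι (j ℤ.+ + m ℤ.* j)       ≈⟨ ι-+ j (+ m ℤ.* j) ⟩
      ι j + ι (+ m ℤ.* j)       ≈⟨ +-cong (sym (*-identityˡ _)) (ι-pos-* m j) ⟩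
      1# * ι j + m · 1# * ι j   ≈⟨ distribʳ _ _ _ ⟨
      suc m · 1# * ι j          ∎

  ι-* : ∀ i j → ι (i ℤ.* j) ≈ ι i * ι j
  ι-* (+ m)    j = ι-pos-* m j
  ι-* -[1+ m ] j = begin
    ι (-[1+ m ] ℤ.* j)        ≈⟨ ι-cong (ℤ.neg-distribˡ-* (+ suc m) j) ⟨
    ι (ℤ.- (+ suc m ℤ.* j))   ≈⟨ ι-neg (+ suc m ℤ.* j) ⟩
    - ι (+ suc m ℤ.* j)       ≈⟨ -‿cong (ι-pos-* (suc m) j) ⟩
    - (suc m · 1# * ι j)      ≈⟨ -‿distribˡ-* _ _ ⟩
    - (suc m · 1#) * ι j      ∎

  -- As coefficient map of the ring solver it admits integer constants in equations. There `con 1ℤ`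
  -- means `ι 1ℤ`, which is `1# + 0#`; hence the conversions by `ι-1`.
  ι-morphism : ℤ.+-*-rawRing -Raw-AlmostCommutative⟶ fromCommutativeRing R
  ι-morphism = record
    { ⟦_⟧ = ι ; +-homo = ι-+ ; *-homo = ι-* ; -‿homo = ι-neg ; 0-homo = refl ; 1-homo = ι-1 }

  ι-≟ : WeaklyDecidable (Induced-equivalence ι-morphism)
  ι-≟ i j with i ℤ.≟ j
  ... | yes i≡j = just (ι-cong i≡j)
  ... | no _    = nothing

  module Solver = RingSolver ℤ.+-*-rawRing (fromCommutativeRing R) ι-morphism ι-≟

-- Order, integer parts and connectedness of the real line.

module RealProperties (lem : ∀ {ℓ} → ExcludedMiddle ℓ) (ℝ : Reals) where

  open Reals ℝ public hiding (zero)
  open IntegerEmbedding commutativeRing public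
  open Solver using (solve; _:=_; _:+_; _:*_; _:-_; :-_; con)
  open AbelianGroupProperties +-abelianGroup 
    using (∙-cancelˡ; ⁻¹-involutive; ⁻¹-injective; ε⁻¹≈ε)

  <⇒≱ : ∀ {x y} → x < y → ¬ y ≤ x
  <⇒≱ = ToStrict.<⇒≱ _≈_ _≤_ antisym

  ≰⇒> : ∀ {x y} → ¬ x ≤ y → y < x
  ≰⇒> = ToStrict.≰⇒> _≈_ _≤_ sym ≤-reflexive total

  ≤-resp₂ : ∀ {x x′ y y′} → x ≈ x′ → y ≈ y′ → x ≤ y → x′ ≤ y′
  ≤-resp₂ p q = ≤-respˡ-≈ p ∘ ≤-respʳ-≈ q

  <-resp₂ : ∀ {x x′ y y′} → x ≈ x′ → y ≈ y′ → x < y → x′ < y′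
  <-resp₂ p q = <-respˡ-≈ p ∘ <-respʳ-≈ q

  +-monoʳ-< : ∀ x {y z} → y < z → x + y < x + z
  +-monoʳ-< x (y≤z , y≉z) = +-monoʳ-≤ x y≤z , y≉z ∘ ∙-cancelˡ x _ _

  +-mono-≤ : ∀ {x y u v} → x ≤ y → u ≤ v → x + u ≤ y + v
  +-mono-≤ {x} {y} {u} {v} x≤y u≤v = ≤-trans (+-monoʳ-≤ x u≤v)
    (≤-resp₂ (+-comm v x) (+-comm v y) (+-monoʳ-≤ v x≤y))

  neg-mono-≤ : ∀ {x y} → x ≤ y → - y ≤ - x
  neg-mono-≤ {x} {y} x≤y = ≤-resp₂
    (solve 2 (λ x y → (:- x :- y) :+ x := :- y) refl x y)
    (solve 2 (λ x y → (:- x :- y) :+ y := :- x) refl x y)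
    (+-monoʳ-≤ (- x - y) x≤y)

  neg-mono-< : ∀ {x y} → x < y → - y < - x
  neg-mono-< (x≤y , x≉y) = neg-mono-≤ x≤y , x≉y ∘ sym ∘ ⁻¹-injective

  *-monoˡ-≤ : ∀ {c} → 0# ≤ c → ∀ {x y} → x ≤ y → c * x ≤ c * y
  *-monoˡ-≤ {c} 0≤c {x} {y} x≤y = ≤-resp₂ (+-identityʳ _)
    (solve 3 (λ c x y → c :* x :+ c :* (y :- x) := c :* y) refl c x y)
    (+-monoʳ-≤ (c * x) (*-nonNeg 0≤c (≤-resp₂ (-‿inverseˡ x) (+-comm _ _) (+-monoʳ-≤ (- x) x≤y))))

  *-cancelˡ-≈ : ∀ {c} → ¬ c ≈ 0# → ∀ {x y} → c * x ≈ c * y → x ≈ y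
  *-cancelˡ-≈ {c} c≉0 {x} {y} cx≈cy with d , cd≈1 ← inverse c c≉0 =
    trans (sym (undo x)) (trans (*-congˡ cx≈cy) (undo y))
    where
    undo : ∀ x → d * (c * x) ≈ x
    undo x = trans (solve 3 (λ c d x → d :* (c :* x) := (c :* d) :* x) refl c d x)
                   (trans (*-congʳ cd≈1) (*-identityˡ x))

  *-cancelˡ-< : ∀ {c} → 0# < c → ∀ {x y} → c * x < c * y → x < y
  *-cancelˡ-< (0≤c , _) cx<cy = ≰⇒> λ y≤x → <⇒≱ cx<cy (*-monoˡ-≤ 0≤c y≤x)

  *-monoˡ-< : ∀ {c} → 0# < c → ∀ {x y} → x < y → c * x < c * y
  *-monoˡ-< (0≤c , 0≉c) (x≤y , x≉y) =
    *-monoˡ-≤ 0≤c x≤y , x≉y ∘ *-cancelˡ-≈ (0≉c ∘ sym)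

  0<1 : 0# < 1#
  0<1 = 0≤1 , 0≉1

  ι-nonneg : ∀ n → 0# ≤ ι (+ n)
  ι-nonneg zero    = ≤-refl
  ι-nonneg (suc n) = ≤-respˡ-≈ (+-identityˡ 0#) (+-mono-≤ 0≤1 (ι-nonneg n))

  ι-suc-pos : ∀ n → 0# < ι (+ suc n)
  ι-suc-pos n = <-≤-trans 0<1 (≤-respˡ-≈ (+-identityʳ 1#) (+-monoʳ-≤ 1# (ι-nonneg n)))

  -- Otherwise `j + 1` would be at most `i`, and `ι` preserves that. This is how real estimates
  -- become statements about integers.
  ι-≤-reflect : ∀ {i j} → ι i < ι j + 1# → i ℤ.≤ j
  ι-≤-reflect {i} {j} ιi<ιj+1 with i ℤ.≤? j
  ... | yes i≤j = i≤j
  ... | no i≰j  = contradiction ιj+1≤ιi (<⇒≱ ιi<ιj+1)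
    where
    gap = i ℤ.- (j ℤ.+ 1ℤ)
    0≤gap : 0ℤ ℤ.≤ gap
    0≤gap = ℤ.i≤j⇒0≤j-i (≡.subst (ℤ._≤ i) (ℤ.+-comm 1ℤ j) (ℤ.i<j⇒suc[i]≤j (ℤ.≰⇒> i≰j)))
    ι-nonneg-ℤ : ∀ {k} → 0ℤ ℤ.≤ k → 0# ≤ ι k
    ι-nonneg-ℤ {+ n} _ = ι-nonneg n
    ιj+1≤ιi : ι j + 1# ≤ ι i
    ιj+1≤ιi = ≤-resp₂ (+-identityʳ _) (begin
      ι j + 1# + ι gap               ≈⟨ +-congˡ (trans (ι-+ i _) (+-congˡ (ι-neg (j ℤ.+ 1ℤ)))) ⟩
      ι j + 1# + (ι i - ι (j ℤ.+ 1ℤ)) ≈⟨ +-congˡ (+-congˡ (-‿cong (trans (ι-+ j 1ℤ) (+-congˡ ι-1)))) ⟩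
      ι j + 1# + (ι i - (ι j + 1#))  ≈⟨ solve 2 (λ a b → a :+ (b :- a) := b) refl (ι j + 1#) (ι i) ⟩
      ι i ∎) (+-monoʳ-≤ (ι j + 1#) (ι-nonneg-ℤ 0≤gap))
      where open ≈-Reasoning setoid

  ι-injective : ∀ {i j} → ι i ≈ ι j → i ≡ j
  ι-injective {i} {j} ιi≈ιj = ℤ.≤-antisym
    (ι-≤-reflect (<-respˡ-≈ (sym ιi≈ιj) (x<x+1 (ι j))))
    (ι-≤-reflect (<-respˡ-≈ ιi≈ιj (x<x+1 (ι i))))

  ι-≉0 : ∀ {i} → ¬ i ≡ 0ℤ → ¬ ι i ≈ 0#
  ι-≉0 i≢0 ιi≈0 = i≢0 (ι-injective ιi≈0)

  -- If `x` bounded all naturals, they would have a supremum `s`; but `n + 1` being below `s` for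
  -- every `n` makes `s - 1#` a smaller upper bound.
  archimedes : ∀ x → ∃ λ n → x < ι (+ n)
  archimedes x with lem {P = ∃ λ n → x < ι (+ n)}
  ... | yes p = p
  ... | no ∄n = contradiction (s-least bounded) (<⇒≱ (x-1<x s))
    where
    Nat : Pred Carrier 0ℓ
    Nat y = ∃ λ n → y ≈ ι (+ n)

    all-≤ : ∀ n → ι (+ n) ≤ x
    all-≤ n with lem {P = ι (+ n) ≤ x}
    ... | yes ≤x = ≤x
    ... | no ≰x  = contradiction (n , ≰⇒> ≰x) ∄n

    sup = supremum Nat (0# , 0 , refl) (x , λ (n , y≈) → ≤-respˡ-≈ (sym y≈) (all-≤ n))
    s = proj₁ sup
    s-upper = proj₁ (proj₂ sup)
    s-least = proj₂ (proj₂ sup)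

    bounded : UpperBound Nat (s - 1#)
    bounded (n , y≈) = ≤-resp₂
      (trans (solve 1 (λ a → :- con 1ℤ :+ (con 1ℤ :+ a) := a) refl _)
             (sym y≈))
      (trans (+-comm _ _) (+-congˡ (-‿cong ι-1)))
      (+-monoʳ-≤ (- ι 1ℤ) (≤-respˡ-≈ (+-congʳ (sym ι-1)) (s-upper (suc n , refl))))

  -- Adding a natural `m` above `- x` makes the number nonnegative; the search then descends from a
  -- natural exceeding it.
  floor : ∀ x → ∃ λ k → ι k ≤ x × x < ι k + 1#
  floor x with archimedes (- x)
  ... | m , -x<m =
    let k , k≤y , y<k+1 = search (proj₁ (archimedes y)) (proj₂ (archimedes y))
    in k ℤ.- + m , lower k k≤y , upper k y<k+1
    where
    y = x + ι (+ m)

    0≤y : 0# ≤ y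
    0≤y = ≤-respˡ-≈ (-‿inverseʳ x) (+-monoʳ-≤ x (proj₁ -x<m))

    search : ∀ n → y < ι (+ n) → ∃ λ k → ι k ≤ y × y < ι k + 1#
    search zero    y<0 = contradiction 0≤y (<⇒≱ y<0)
    search (suc n) y<n+1 with lem {P = ι (+ n) ≤ y}
    ... | yes n≤y = + n , n≤y , <-respʳ-≈ (+-comm _ _) y<n+1
    ... | no n≰y  = search n (≰⇒> n≰y)

    ι-shift : ∀ k → ι (k ℤ.- + m) ≈ - ι (+ m) + ι k
    ι-shift k = trans (ι-+ k (ℤ.- + m)) (trans (+-comm _ _) (+-congʳ (ι-neg (+ m))))

    lower : ∀ k → ι k ≤ y → ι (k ℤ.- + m) ≤ x
    lower k k≤y = ≤-resp₂ (sym (ι-shift k))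
      (solve 2 (λ a x → :- a :+ (x :+ a) := x) refl _ x)
      (+-monoʳ-≤ (- ι (+ m)) k≤y)

    upper : ∀ k → y < ι k + 1# → x < ι (k ℤ.- + m) + 1#
    upper k y<k+1 = <-resp₂
      (solve 2 (λ a x → :- a :+ (x :+ a) := x) refl _ x)
      (trans (sym (+-assoc _ _ _)) (+-congʳ (sym (ι-shift k))))
      (+-monoʳ-< (- ι (+ m)) y<k+1)

  between : ∀ {x y} → x < y → ∃ λ z → x < z × z < y
  between {x} {y} x<y = h * (x + y) ,
    *-cancelˡ-< 0<2 (<-resp₂ (twice x) (sym (double (x + y))) (+-monoʳ-< x x<y)) ,
    *-cancelˡ-< 0<2 (<-resp₂ (trans (+-comm y x) (sym (double (x + y)))) (twice y) (+-monoʳ-< y x<y))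
    where
    0<2 = ι-suc-pos 1
    half = inverse (ι (+ 2)) (proj₂ 0<2 ∘ sym)
    h = proj₁ half
    twice : ∀ z → z + z ≈ ι (+ 2) * z
    twice = solve 1 (λ z → z :+ z := con (+ 2) :* z) refl
    double : ∀ z → ι (+ 2) * (h * z) ≈ z
    double z = trans (sym (*-assoc _ _ _)) (trans (*-congʳ (proj₂ half)) (*-identityˡ z))

  τℝ : Topology setoid 0ℓ
  τℝ = ℝ-topology ℝ

  negation-continuous : Continuous τℝ τℝ (λ x → - x)
  negation-continuous V (resp , nbhd) = resp ∘ -‿cong , λ x -x∈V →
    let l , r , l<-x , -x<r , inV = nbhd (- x) -x∈V
    in - r , - l , swapˡ -x<r , swapʳ l<-x ,
       λ y -r<y y<-l → inV (- y) (swapʳ y<-l) (swapˡ -r<y)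
    where
    swapˡ : ∀ {x y} → - x < y → - y < x
    swapˡ -x<y = <-respʳ-≈ (⁻¹-involutive _) (neg-mono-< -x<y)
    swapʳ : ∀ {x y} → x < - y → y < - x
    swapʳ x<-y = <-respˡ-≈ (⁻¹-involutive _) (neg-mono-< x<-y)

  private
    affine-continuous-pos : ∀ a {c} → 0# < c → Continuous τℝ τℝ (λ x → a + x * c)
    affine-continuous-pos a {c} 0<c V (resp , nbhd) =
      (λ x≈y → resp (+-congˡ (*-congʳ x≈y))) , λ x fx∈V →
        let l , r , l<fx , fx<r , inV = nbhd (a + x * c) fx∈V
        -- The inverse affine map, with `d` the inverse of `c`, carries the interval back.
        in d * (l - a) , d * (r - a) ,
           *-cancelˡ-< 0<c (<-resp₂ (sym (undo _)) (drop x) (+-monoʳ-< (- a) l<fx)) ,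
           *-cancelˡ-< 0<c (<-resp₂ (drop x) (sym (undo _)) (+-monoʳ-< (- a) fx<r)) ,
           λ y l<y y<r → inV (a + y * c)
             (<-resp₂ (add l) (+-congˡ (*-comm c y)) (+-monoʳ-< a (*-monoˡ-< 0<c l<y)))
             (<-resp₂ (+-congˡ (*-comm c y)) (add r) (+-monoʳ-< a (*-monoˡ-< 0<c y<r)))
      where
      inv = inverse c (proj₂ 0<c ∘ sym)
      d = proj₁ inv
      undo : ∀ l → c * (d * (l - a)) ≈ - a + l
      undo l = trans (sym (*-assoc _ _ _)) (trans (*-congʳ (proj₂ inv))
                 (trans (*-identityˡ _) (+-comm _ _)))
      drop : ∀ x → - a + (a + x * c) ≈ c * x
      drop x = solve 3 (λ a x c → :- a :+ (a :+ x :* c) := c :* x) refl a x c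
      add : ∀ l → a + c * (d * (l - a)) ≈ l
      add l = trans (+-congˡ (undo l)) (solve 2 (λ a l → a :+ (:- a :+ l) := l) refl a l)

  affine-continuous : ∀ a c → Continuous τℝ τℝ (λ x → a + x * c)
  affine-continuous a c V V-open@(resp , _) with lem {P = c ≈ 0#} | total 0# c
  ... | yes c≈0 | _ =
    (λ x≈y → resp (+-congˡ (*-congʳ x≈y))) , λ x fx∈V →
      x - 1# , x + 1# , x-1<x x , x<x+1 x , λ y _ _ → resp (+-congˡ (constant x y)) fx∈V
    where
    constant : ∀ x y → x * c ≈ y * c
    constant x y = trans (trans (*-congˡ c≈0) (zeroʳ x)) (sym (trans (*-congˡ c≈0) (zeroʳ y)))
  ... | no c≉0 | inj₁ 0≤c = affine-continuous-pos a (0≤c , c≉0 ∘ sym) V V-open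
  -- A negative slope is negation followed by the positive slope `- c`.
  ... | no c≉0 | inj₂ c≤0 = Topology.Open-resp-≐ τℝ
    ((λ {x} → resp (same x)) , λ {x} → resp (sym (same x)))
    (negation-continuous _ (affine-continuous-pos a
      (<-respˡ-≈ ε⁻¹≈ε (neg-mono-< (c≤0 , c≉0))) V V-open))
    where
    same : ∀ x → a + - x * - c ≈ a + x * c
    same x = solve 3 (λ a x c → a :+ (:- x) :* (:- c) := a :+ x :* c) refl a x c

  private
    -- The supremum of V below w belongs to V or to W, and either way V and
    -- W meet near it.
    meet : ∀ V W → Open τℝ V → Open τℝ W → U ⊆ V ∪ W →
           ∀ {v w} → v ∈ V → w ∈ W → v ≤ w → V ≬ W
    meet V W (respV , nbhdV) (respW , nbhdW) cover {v} {w} v∈V w∈W v≤w = from (cover _)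
      where
      Below : Pred Carrier 0ℓ
      Below x = x ∈ V × x ≤ w
      sup = supremum Below (v , v∈V , v≤w) (w , proj₂)
      s = proj₁ sup
      s-upper = proj₁ (proj₂ sup)
      s-least = proj₂ (proj₂ sup)
      s≤w : s ≤ w
      s≤w = s-least proj₂

      from : s ∈ V ⊎ s ∈ W → V ≬ W
      from (inj₁ s∈V) with lem {P = s ≈ w}
      ... | yes s≈w = w , respV s≈w s∈V , w∈W
      ... | no s≉w with nbhdV s s∈V
      ...   | l , r , l<s , s<r , inV with total r w
      ...     | inj₁ r≤w = let z , s<z , z<r = between s<r in
        contradiction (s-upper (inV z (<-≤-trans l<s (proj₁ s<z)) z<r , ≤-trans (proj₁ z<r) r≤w)) (<⇒≱ s<z)
      ...     | inj₂ w≤r = let z , s<z , z<w = between (s≤w , s≉w) in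
        contradiction (s-upper (inV z (<-≤-trans l<s (proj₁ s<z)) (<-≤-trans z<w w≤r) , proj₁ z<w)) (<⇒≱ s<z)
      from (inj₂ s∈W) with nbhdW s s∈W
      ... | l , r , l<s , s<r , inW with lem {P = ∃ λ x → x ∈ Below × l < x}
      ...   | yes (x , x∈ , l<x) = x , proj₁ x∈ , inW x l<x (≤-<-trans (s-upper x∈) s<r)
      ...   | no ∄x = contradiction (s-least upper) (<⇒≱ l<s)
        where
        upper : UpperBound Below l
        upper {x} x∈ with lem {P = x ≤ l}
        ... | yes x≤l = x≤l
        ... | no x≰l  = contradiction (x , x∈ , ≰⇒> x≰l) ∄x

  ℝ-connected : Connected τℝ U
  ℝ-connected = (0# , tt) , λ V W V-open W-open cover (v , _ , v∈V) (w , _ , w∈W) →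
    split V W V-open W-open (λ {x} → cover {x}) v∈V w∈W (total v w)
    where
    split : ∀ V W → Open τℝ V → Open τℝ W → U ⊆ V ∪ W →
            ∀ {v w} → v ∈ V → w ∈ W → v ≤ w ⊎ w ≤ v → U ≬ (V ∩ W)
    split V W V-open W-open cover v∈V w∈W (inj₁ v≤w) =
      let x , x∈V , x∈W = meet V W V-open W-open cover v∈V w∈W v≤w in x , tt , x∈V , x∈W
    split V W V-open W-open cover v∈V w∈W (inj₂ w≤v) =
      let x , x∈W , x∈V = meet W V W-open V-open (λ {x} _ → swap (cover {x} tt)) w∈W v∈V w≤v
      in x , tt , x∈V , x∈W
      where
      swap : ∀ {A B : Set} → A ⊎ B → B ⊎ A
      swap (inj₁ a) = inj₂ a
      swap (inj₂ b) = inj₁ b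

-- Integer vectors.

unit : ∀ {n} → Fin n → Fin n → ℤ
unit i k = when (i Fin.≟ k) 1ℤ

unit-suc : ∀ {n} (i k : Fin n) → unit (suc i) (suc k) ≡ unit i k
unit-suc i k = when-⇔ (suc i Fin.≟ suc k) (i Fin.≟ k) Fin.suc-injective (≡.cong suc) 1ℤ

-- The unit vectors generate: a vector is a multiple of the first one plus a vector starting with
-- zero, to which induction applies. `resp` takes the place of function extensionality.
ℤ^-induction : ∀ {n p} (P : Pred (Fin n → ℤ) p) →
  (∀ {v w} → v ≗ w → P v → P w) → P (λ _ → 0ℤ) →
  (∀ {v w} → P v → P w → P (λ i → v i ℤ.+ w i)) →
  (∀ {v} → P v → P (λ i → ℤ.- v i)) →
  (∀ i → P (unit i)) → ∀ v → P v
ℤ^-induction {zero}  P resp P0 P+ P- Pe v = resp (λ ()) P0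
ℤ^-induction {suc n} P resp P0 P+ P- Pe v =
  resp recombine (P+ (multiple (v zero) (Pe zero)) (extend (v ∘ suc)))
  where
  multiple-ℕ : ∀ k {w} → P w → P (λ i → + k ℤ.* w i)
  multiple-ℕ zero    {w} _  = resp (λ i → ≡.sym (ℤ.*-zeroˡ (w i))) P0
  multiple-ℕ (suc k) {w} Pw = resp (λ i → ≡.sym (ℤ.suc-* (+ k) (w i))) (P+ Pw (multiple-ℕ k Pw))

  multiple : ∀ k {w} → P w → P (λ i → k ℤ.* w i)
  multiple (+ k)    Pw = multiple-ℕ k Pw
  multiple -[1+ k ] {w} Pw =
    resp (λ i → ℤ.neg-distribˡ-* (+ suc k) (w i)) (P- (multiple-ℕ (suc k) Pw))

  0∷_ : (Fin n → ℤ) → Fin (suc n) → ℤ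
  (0∷ w) zero    = 0ℤ
  (0∷ w) (suc i) = w i

  extend : ∀ w → P (0∷ w)
  extend = ℤ^-induction (P ∘ 0∷_)
    (λ v≗w → resp λ { zero → ≡.refl ; (suc i) → v≗w i })
    (resp (λ { zero → ≡.refl ; (suc i) → ≡.refl }) P0)
    (λ Pv Pw → resp (λ { zero → ≡.refl ; (suc i) → ≡.refl }) (P+ Pv Pw))
    (λ Pv → resp (λ { zero → ≡.refl ; (suc i) → ≡.refl }) (P- Pv))
    (λ i → resp (λ { zero → ≡.refl ; (suc k) → unit-suc i k }) (Pe (suc i)))

  recombine : ∀ i → v zero ℤ.* unit zero i ℤ.+ (0∷ (v ∘ suc)) i ≡ v i
  recombine zero    = ≡.trans (ℤ.+-identityʳ _) (ℤ.*-identityʳ (v zero))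
  recombine (suc i) = ≡.trans (≡.cong (ℤ._+ v (suc i)) (ℤ.*-zeroʳ (v zero))) (ℤ.+-identityˡ _)

-- The sum norm, which bounds the linear form `v` on the cube of points with coordinates between -1
-- and 1.
norm : ∀ {n} → (Fin n → ℤ) → ℕ
norm {zero}  v = 0
norm {suc n} v = ℤ.∣ v zero ∣ ℕ.+ norm (v ∘ suc)

-- Integral linear forms and the circle.

module LinearForms (lem : ∀ {ℓ} → ExcludedMiddle ℓ) (ℝ : Reals) where

  open RealProperties lem ℝ public
  open Solver using (solve; _:=_; _:+_; _:*_; _:-_; :-_; con)
  open CommutativeMonoidSum +-commutativeMonoid
    using (sum; sum-cong-≋; sum-replicate-zero; ∑-distrib-+)
  open SemiringSum semiring using (*-distribˡ-sum)
  open AbelianGroupProperties +-abelianGroup using (ε⁻¹≈ε)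
  open ≈-Reasoning setoid

  dot : ∀ {n} → (Fin n → ℤ) → (Fin n → Carrier) → Carrier
  dot v x = sum λ i → ι (v i) * x i

  module _ {n : ℕ} where

    dot-cong : {v w : Fin n → ℤ} {x y : Fin n → Carrier} →
               v ≗ w → (∀ i → x i ≈ y i) → dot v x ≈ dot w y
    dot-cong v≗w x≈y = sum-cong-≋ λ i → *-cong (ι-cong (v≗w i)) (x≈y i)

    dot-0 : (x : Fin n → Carrier) → dot (λ _ → 0ℤ) x ≈ 0#
    dot-0 x = trans (sum-cong-≋ {n} λ i → zeroˡ (x i)) (sum-replicate-zero n)

    dot-+ : (v w : Fin n → ℤ) (x : Fin n → Carrier) →
            dot (λ i → v i ℤ.+ w i) x ≈ dot v x + dot w x
    dot-+ v w x = trans (sum-cong-≋ λ i → trans (*-congʳ (ι-+ (v i) (w i))) (distribʳ _ _ _))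
                        (∑-distrib-+ (λ i → ι (v i) * x i) _)

    dot-scale : (k : ℤ) (v : Fin n → ℤ) (x : Fin n → Carrier) →
                dot (λ i → k ℤ.* v i) x ≈ ι k * dot v x
    dot-scale k v x = trans
      (sum-cong-≋ λ i → trans (*-congʳ (ι-* k (v i))) (*-assoc _ _ _))
      (sym (*-distribˡ-sum (ι k) (λ i → ι (v i) * x i)))

    dot-neg : (v : Fin n → ℤ) (x : Fin n → Carrier) →
              dot (λ i → ℤ.- v i) x ≈ - dot v x
    dot-neg v x = begin
      dot (λ i → ℤ.- v i) x          ≈⟨ dot-cong (λ i → ≡.sym (ℤ.-1*i≡-i (v i))) (λ _ → refl) ⟩
      dot (λ i → ℤ.-1ℤ ℤ.* v i) x    ≈⟨ dot-scale ℤ.-1ℤ v x ⟩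
      ι ℤ.-1ℤ * dot v x              ≈⟨ solve 1 (λ z → con ℤ.-1ℤ :* z := :- z) refl (dot v x) ⟩
      - dot v x                      ∎

    dot-affine : (v : Fin n → ℤ) (x y : Fin n → Carrier) (s : Carrier) →
                 dot v (λ i → x i + s * y i) ≈ dot v x + s * dot v y
    dot-affine v x y s = begin
      dot v (λ i → x i + s * y i)
        ≈⟨ sum-cong-≋ (λ i → solve 4 (λ v x s y → v :* (x :+ s :* y) := v :* x :+ s :* (v :* y))
             refl (ι (v i)) (x i) s (y i)) ⟩
      sum (λ i → ι (v i) * x i + s * (ι (v i) * y i))
        ≈⟨ ∑-distrib-+ (λ i → ι (v i) * x i) _ ⟩
      dot v x + sum (λ i → s * (ι (v i) * y i))
        ≈⟨ +-congˡ (*-distribˡ-sum s (λ i → ι (v i) * y i)) ⟨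
      dot v x + s * dot v y ∎

    dot-difference : (v : Fin n → ℤ) (x y : Fin n → Carrier) →
                     dot v (λ i → x i - y i) ≈ dot v x - dot v y
    dot-difference v x y = begin
      dot v (λ i → x i - y i)
        ≈⟨ dot-cong {v} (λ _ → ≡.refl) (λ i →
             solve 2 (λ x y → x :- y := x :+ con ℤ.-1ℤ :* y) refl (x i) (y i)) ⟩
      dot v (λ i → x i + ι ℤ.-1ℤ * y i)  ≈⟨ dot-affine v x y (ι ℤ.-1ℤ) ⟩
      dot v x + ι ℤ.-1ℤ * dot v y
        ≈⟨ solve 2 (λ x y → x :+ con ℤ.-1ℤ :* y := x :- y) refl (dot v x) (dot v y) ⟩
      dot v x - dot v y ∎

    dot-comm : (v w : Fin n → ℤ) → dot v (ι ∘ w) ≈ dot w (ι ∘ v)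
    dot-comm v w = sum-cong-≋ λ i → *-comm (ι (v i)) (ι (w i))

    dot-multiple : (v : Fin n → ℤ) (x : Fin n → Carrier) (c : Carrier) →
                   dot v (λ i → c * x i) ≈ c * dot v x
    dot-multiple v x c = trans
      (sum-cong-≋ λ i → solve 3 (λ v c x → v :* (c :* x) := c :* (v :* x)) refl (ι (v i)) c (x i))
      (sym (*-distribˡ-sum c (λ i → ι (v i) * x i)))

  dot-unit : ∀ {n} (i : Fin n) (x : Fin n → Carrier) → dot (unit i) x ≈ x i
  dot-unit {suc n} zero x = begin
    ι 1ℤ * x zero + dot {n} (λ _ → 0ℤ) (x ∘ suc)
      ≈⟨ +-cong (solve 1 (λ x → con 1ℤ :* x := x) refl (x zero)) (dot-0 {n} (x ∘ suc)) ⟩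
    x zero + 0#                               ≈⟨ +-identityʳ _ ⟩
    x zero                                    ∎
  dot-unit {suc n} (suc i) x = begin
    0# * x zero + dot (unit (suc i) ∘ suc) (x ∘ suc)
      ≈⟨ +-cong (zeroˡ _) (trans (dot-cong (unit-suc i) λ _ → refl) (dot-unit i (x ∘ suc))) ⟩
    0# + x (suc i)                            ≈⟨ +-identityˡ _ ⟩
    x (suc i)                                 ∎

  Bounded : ℕ → Pred Carrier 0ℓ
  Bounded n x = x ≤ ι (+ n) × - x ≤ ι (+ n)

  bounded-resp : ∀ {n x y} → x ≈ y → Bounded n x → Bounded n y
  bounded-resp x≈y (u , l) = ≤-respˡ-≈ x≈y u , ≤-respˡ-≈ (-‿cong x≈y) l

  bounded-+ : ∀ {m n x y} → Bounded m x → Bounded n y → Bounded (m ℕ.+ n) (x + y)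
  bounded-+ {m} {n} {x} {y} (x≤ , -x≤) (y≤ , -y≤) =
    ≤-respʳ-≈ (sym (ι-+ (+ m) (+ n))) (+-mono-≤ x≤ y≤) ,
    ≤-resp₂ (solve 2 (λ x y → :- x :+ :- y := :- (x :+ y)) refl x y)
            (sym (ι-+ (+ m) (+ n))) (+-mono-≤ -x≤ -y≤)

  bounded-neg : ∀ {n x} → Bounded n x → Bounded n (- x)
  bounded-neg {x = x} (x≤ , -x≤) =
    -x≤ , ≤-respˡ-≈ (solve 1 (λ x → x := :- (:- x)) refl x) x≤

  bounded-* : ∀ k {x} → Bounded 1 x → Bounded ℤ.∣ k ∣ (ι k * x)
  bounded-* (+ n) {x} (x≤ , -x≤) =
    ≤-respʳ-≈ ι-n*1 (*-monoˡ-≤ (ι-nonneg n) x≤) ,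
    ≤-resp₂ (solve 2 (λ n x → n :* (:- x) := :- (n :* x)) refl (ι (+ n)) x) ι-n*1
      (*-monoˡ-≤ (ι-nonneg n) -x≤)
    where
    ι-n*1 : ι (+ n) * ι 1ℤ ≈ ι (+ n)
    ι-n*1 = trans (*-congˡ ι-1) (*-identityʳ _)
  bounded-* -[1+ n ] {x} b =
    bounded-resp {suc n} (solve 2 (λ n x → :- (n :* x) := (:- n) :* x) refl (ι (+ suc n)) x)
      (bounded-neg {suc n} (bounded-* (+ suc n) b))

  bounded-dot : ∀ {n} (v : Fin n → ℤ) {x : Fin n → Carrier} →
                (∀ i → Bounded 1 (x i)) → Bounded (norm v) (dot v x)
  bounded-dot {zero}  v b = ≤-refl , ≤-reflexive ε⁻¹≈ε
  bounded-dot {suc n} v b =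
    bounded-+ {ℤ.∣ v zero ∣} (bounded-* (v zero) (b zero)) (bounded-dot (v ∘ suc) (b ∘ suc))

  -- From `n k ≤ m < n` follows `k < 1`, and the same holds for the negative of `k`.
  bounded-integer : ∀ {m n} k → m ℕ.< n → Bounded m (ι (+ n) * ι k) → k ≡ 0ℤ
  bounded-integer {m} {n} k m<n (nk≤m , -nk≤m) =
    ℤ.≤-antisym (nonpositive k nk≤m)
      (≡.subst (0ℤ ℤ.≤_) (ℤ.neg-involutive k) (ℤ.neg-mono-≤ (nonpositive (ℤ.- k)
        (≤-respˡ-≈ (trans (solve 2 (λ n k → :- (n :* k) := n :* (:- k)) refl (ι (+ n)) (ι k))
                          (*-congˡ (sym (ι-neg k)))) -nk≤m))))
    where
    nonpositive : ∀ k → ι (+ n) * ι k ≤ ι (+ m) → k ℤ.≤ 0ℤ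
    nonpositive k nk≤m = ℤ.i<j⇒i≤pred[j] {j = 1ℤ} (ℤ.*-cancelˡ-<-nonNeg (+ n)
      (≡.subst (+ n ℤ.* k ℤ.<_) (≡.sym (ℤ.*-identityʳ (+ n)))
      (ℤ.≤-<-trans (ι-≤-reflect {+ n ℤ.* k} {+ m} (≤-<-trans (≤-respˡ-≈ (sym (ι-* (+ n) k)) nk≤m) (x<x+1 _)))
                   (ℤ.+<+ m<n))))

  infix 4 _~_
  _~_ : Carrier → Carrier → Set
  _~_ = _∼_ ℝ

  ~⁺ : ∀ {x y} k → x ≈ y + ι k → x ~ y
  ~⁺ (+ n)    x≈y+k = 0 , n , trans (+-identityʳ _) x≈y+k
  ~⁺ {y = y} -[1+ n ] x≈y+k = suc n , 0 ,
    trans (+-congʳ x≈y+k) (solve 2 (λ y n → y :- n :+ n := y :+ con 0ℤ) refl y (ι (+ suc n)))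

  ~⁻ : ∀ {x y} → x ~ y → ∃ λ k → x ≈ y + ι k
  ~⁻ {x} {y} (m , n , eq) = + n ℤ.- + m , (begin
    x                                ≈⟨ solve 2 (λ x m → x := x :+ m :- m) refl x (ι (+ m)) ⟩
    x + ι (+ m) - ι (+ m)            ≈⟨ +-congʳ eq ⟩
    y + ι (+ n) - ι (+ m)            ≈⟨ +-assoc _ _ _ ⟩
    y + (ι (+ n) - ι (+ m))          ≈⟨ +-congˡ (trans (ι-+ (+ n) (ℤ.- + m)) (+-congˡ (ι-neg (+ m)))) ⟨
    y + ι (+ n ℤ.- + m)              ∎)

  ~-scale : ∀ k {x y} → x ~ y → ι k * x ~ ι k * y
  ~-scale k {x} {y} x~y with l , x≈y+l ← ~⁻ x~y = ~⁺ (k ℤ.* l) (begin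
    ι k * x                ≈⟨ *-congˡ x≈y+l ⟩
    ι k * (y + ι l)        ≈⟨ distribˡ _ _ _ ⟩
    ι k * y + ι k * ι l    ≈⟨ +-congˡ (ι-* k l) ⟨
    ι k * y + ι (k ℤ.* l)  ∎)

  -- The circle is cut into `N` arcs of length `1 / N`. For `k` the floor of `N x`, the remainder of
  -- `k` modulo `N` names the arc, and subtracting the quotient from `x` gives the representative
  -- `y`.
  residue : ∀ N .{{_ : ℕ.NonZero N}} x →
    ∃₂ λ (r : Fin N) y → y ~ x × ι (+ toℕ r) ≤ ι (+ N) * y × ι (+ N) * y < ι (+ toℕ r) + 1#
  residue N x =
    r , x - ι q , ~⁺ (ℤ.- q) (+-congˡ (sym (ι-neg q))) ,
    ≤-resp₂ r≈ shift (+-monoʳ-≤ (- (ι q * ι (+ N))) k≤Nx) ,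
    <-resp₂ shift (trans (sym (+-assoc _ _ _)) (+-congʳ r≈)) (+-monoʳ-< (- (ι q * ι (+ N))) Nx<k+1)
    where
    k = proj₁ (floor (ι (+ N) * x))
    k≤Nx = proj₁ (proj₂ (floor (ι (+ N) * x)))
    Nx<k+1 = proj₂ (proj₂ (floor (ι (+ N) * x)))
    r = fromℕ< (ℤ.n%ℕd<d k N)
    q = k ℤ./ℕ N
    r≈ : - (ι q * ι (+ N)) + ι k ≈ ι (+ toℕ r)
    r≈ = begin
      - (ι q * ι (+ N)) + ι k
        ≈⟨ +-congˡ (trans (ι-cong (ℤ.a≡a%ℕn+[a/ℕn]*n k N))
                   (trans (ι-+ (+ (k ℤ.%ℕ N)) (q ℤ.* + N)) (+-congˡ (ι-* q (+ N))))) ⟩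
      - (ι q * ι (+ N)) + (ι (+ (k ℤ.%ℕ N)) + ι q * ι (+ N))
        ≈⟨ solve 2 (λ a r → :- a :+ (r :+ a) := r) refl (ι q * ι (+ N)) (ι (+ (k ℤ.%ℕ N))) ⟩
      ι (+ (k ℤ.%ℕ N))
        ≈⟨ ι-cong (≡.cong +_ (Fin.toℕ-fromℕ< (ℤ.n%ℕd<d k N))) ⟨
      ι (+ toℕ r) ∎
    shift : - (ι q * ι (+ N)) + ι (+ N) * x ≈ ι (+ N) * (x - ι q)
    shift = solve 3 (λ q N x → :- (q :* N) :+ N :* x := N :* (x :- q)) refl (ι q) (ι (+ N)) x

  same-residue : ∀ {r x y} → ι r ≤ x → x < ι r + 1# → ι r ≤ y → y < ι r + 1# → Bounded 1 (x - y)
  same-residue {r} {x} {y} r≤x x<r+1 r≤y y<r+1 =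
    gap x y (proj₁ x<r+1) r≤y ,
    ≤-respˡ-≈ (solve 2 (λ x y → y :- x := :- (x :- y)) refl x y) (gap y x (proj₁ y<r+1) r≤x)
    where
    gap : ∀ x y → x ≤ ι r + 1# → ι r ≤ y → x - y ≤ ι 1ℤ
    gap x y x≤ r≤y = ≤-respʳ-≈
      (trans (+-congʳ (+-congˡ (sym ι-1))) (solve 1 (λ r → r :+ con 1ℤ :- r := con 1ℤ) refl (ι r)))
      (+-mono-≤ x≤ (neg-mono-≤ r≤y))

  -- If `d` were nonzero, the parameters 0 and `1 / (2 d)` would give two values differing by one
  -- half, although both differ from `c` by integers.
  integral-line⇒constant : ∀ {x c d} → (∀ s → x + s * d ~ c) → d ≈ 0#
  integral-line⇒constant {x} {c} {d} integral with lem {P = d ≈ 0#}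
  ... | yes d≈0 = d≈0
  ... | no d≉0 = contradiction (ι-injective 2k≈1) (even≢1 k)
    where
    two≉0 = ι-≉0 {+ 2} λ ()
    h = proj₁ (inverse (ι (+ 2)) two≉0)
    e = proj₁ (inverse d d≉0)
    i₀ = ~⁻ (integral 0#)
    i₁ = ~⁻ (integral (h * e))
    k = proj₁ i₁ ℤ.- proj₁ i₀

    h≈k : h ≈ ι k
    h≈k = begin
      h                                     ≈⟨ *-identityʳ h ⟨
      h * 1#                                ≈⟨ *-congˡ (proj₂ (inverse d d≉0)) ⟨
      h * (d * e)
        ≈⟨ solve 4 (λ x d e h → h :* (d :* e) := (x :+ (h :* e) :* d) :- (x :+ con 0ℤ :* d)) refl x d e h ⟩
      (x + (h * e) * d) - (x + 0# * d)      ≈⟨ +-cong (proj₂ i₁) (-‿cong (proj₂ i₀)) ⟩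
      (c + ι (proj₁ i₁)) - (c + ι (proj₁ i₀))
        ≈⟨ solve 3 (λ c a b → (c :+ a) :- (c :+ b) := a :- b) refl c _ _ ⟩
      ι (proj₁ i₁) - ι (proj₁ i₀)           ≈⟨ +-congˡ (ι-neg (proj₁ i₀)) ⟨
      ι (proj₁ i₁) + ι (ℤ.- proj₁ i₀)       ≈⟨ ι-+ (proj₁ i₁) (ℤ.- proj₁ i₀) ⟨
      ι k                                   ∎

    2k≈1 : ι (+ 2 ℤ.* k) ≈ ι 1ℤ
    2k≈1 = begin
      ι (+ 2 ℤ.* k)    ≈⟨ ι-* (+ 2) k ⟩
      ι (+ 2) * ι k    ≈⟨ *-congˡ h≈k ⟨
      ι (+ 2) * h      ≈⟨ proj₂ (inverse (ι (+ 2)) two≉0) ⟩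
      1#               ≈⟨ ι-1 ⟨
      ι 1ℤ             ∎

    even≢1 : ∀ k → ¬ + 2 ℤ.* k ≡ 1ℤ
    even≢1 k eq with ℕ.m*n≡1⇒m≡1 2 ℤ.∣ k ∣ (≡.trans (≡.sym (ℤ.abs-* (+ 2) k)) (≡.cong ℤ.∣_∣ eq))
    ... | ()

  τS¹ : Topology _ 0ℓ
  τS¹ = circle-topology ℝ

  -- The points whose m-th multiple is within 1 of m c + k for some k in Q;
  -- on the translate by c of the m-torsion, nearness is equality.
  Near : ℤ → Carrier → Pred ℤ 0ℓ → Pred Carrier 0ℓ
  Near m c Q = ⋃ (Σ ℤ Q) λ (k , _) x →
    ι k < (- (ι m * c) + x * ι m) + 1# × - (ι m * c) + x * ι m < ι k + 1#

  -- Replacing `x` by `x + l` moves `m x` by `m l`, so periodicity of `Q` makes the set well defined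
  -- on the circle. On the line it is a union of preimages of open intervals under an affine map.
  near-open : ∀ m c {Q} → (∀ {k} l → Q k → Q (m ℤ.* l ℤ.+ k)) → Open τS¹ (Near m c Q)
  near-open m c {Q} periodic = respects ,
    Topology.Open-⋃ τℝ (Σ ℤ Q) _ λ (k , _) →
      affine-continuous (- (ι m * c)) (ι m) (λ y → ι k < y + 1# × y < ι k + 1#) (interval k)
    where
    interval : ∀ k → Open τℝ (λ y → ι k < y + 1# × y < ι k + 1#)
    interval k =
      (λ x≈y (l , u) → <-respʳ-≈ (+-congʳ x≈y) l , <-respˡ-≈ x≈y u) ,
      λ x (l , u) → ι k - 1# , ι k + 1# ,
        <-resp₂ (+-comm _ _) (cancel x) (+-monoʳ-< (- 1#) l) , u ,
        λ y l u → <-resp₂ (uncancel (ι k)) (+-comm _ _) (+-monoʳ-< 1# l) , u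
      where
      cancel : ∀ x → - 1# + (x + 1#) ≈ x
      cancel x = solve 2 (λ x u → :- u :+ (x :+ u) := x) refl x 1#
      uncancel : ∀ x → 1# + (x - 1#) ≈ x
      uncancel x = solve 2 (λ x u → u :+ (x :- u) := x) refl x 1#

    respects : ∀ {x y} → x ~ y → Near m c Q x → Near m c Q y
    respects {x} {y} x~y ((k , Qk) , lower , upper)
      with l , y≈x+l ← ~⁻ (AbelianGroup.sym (circle ℝ) x~y) =
      (m ℤ.* l ℤ.+ k , periodic l Qk) ,
      <-resp₂ (sym ι-shift) (trans (sym (+-assoc _ _ _)) (+-congʳ y-shift)) (+-monoʳ-< (ι m * ι l) lower) ,
      <-resp₂ y-shift (trans (sym (+-assoc _ _ _)) (+-congʳ (sym ι-shift))) (+-monoʳ-< (ι m * ι l) upper)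
      where
      ι-shift : ι (m ℤ.* l ℤ.+ k) ≈ ι m * ι l + ι k
      ι-shift = trans (ι-+ (m ℤ.* l) k) (+-congʳ (ι-* m l))
      y-shift : ι m * ι l + (- (ι m * c) + x * ι m) ≈ - (ι m * c) + y * ι m
      y-shift = trans (solve 4 (λ m l c x →
                           m :* l :+ (:- (m :* c) :+ x :* m) := :- (m :* c) :+ (x :+ l) :* m)
                         refl (ι m) (ι l) c x)
                      (+-congˡ (*-congʳ (sym y≈x+l)))

  near-exact : ∀ m c {Q k x} → - (ι m * c) + x * ι m ≈ ι k → Near m c Q x → Q k
  near-exact m c {Q} {k} mx≈k ((l , Ql) , l<k+1 , k<l+1) = ≡.subst Q (ℤ.≤-antisym
    (ι-≤-reflect {l} {k} (<-respʳ-≈ (+-congʳ mx≈k) l<k+1))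
    (ι-≤-reflect {k} {l} (<-respˡ-≈ mx≈k k<l+1))) Ql

  near : ∀ m c {Q : Pred ℤ 0ℓ} {k x} → - (ι m * c) + x * ι m ≈ ι k → Q k → Near m c Q x
  near m c {k = k} mx≈k Qk = (k , Qk) ,
    <-respʳ-≈ (+-congʳ (sym mx≈k)) (x<x+1 _) , <-respˡ-≈ (sym mx≈k) (x<x+1 _)

  -- On `X` the number `m (f x - c)` is an integer, and `f x` equals `c` in the circle exactly when
  -- `m` divides it. Divisible and indivisible integers give two open sets that cover `X` and share
  -- no point of `X`; since `p` is in the first, connectedness leaves nothing for the second.
  torsion-locally-constant : ∀ {S : Setoid 0ℓ 0ℓ} {o} (τ : Topology S o)
    (f : Setoid.Carrier S → Carrier) → Continuous τ τS¹ f →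
    ∀ {X} → Connected τ X → ∀ m c → ¬ m ≡ 0ℤ →
    (∀ {x} → x ∈ X → ι m * f x ~ ι m * c) →
    ∀ {p} → p ∈ X → f p ~ c → ∀ {x} → x ∈ X → f x ~ c
  torsion-locally-constant τ f f-continuous {X} (_ , split) m c m≢0 torsion {p} p∈X fp~c {x} x∈X =
    from (cover x∈X)
    where
    Divisible : Pred ℤ 0ℓ
    Divisible k = ∃ λ q → k ≡ m ℤ.* q

    multiple : ∀ {x} → x ∈ X → ∃ λ k → - (ι m * c) + f x * ι m ≈ ι k
    multiple {x} x∈X = let k , eq = ~⁻ (torsion x∈X) in k , (begin
      - (ι m * c) + f x * ι m      ≈⟨ +-congˡ (*-comm _ _) ⟩
      - (ι m * c) + ι m * f x      ≈⟨ +-congˡ eq ⟩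
      - (ι m * c) + (ι m * c + ι k) ≈⟨ solve 2 (λ a k → :- a :+ (a :+ k) := k) refl (ι m * c) (ι k) ⟩
      ι k                          ∎)

    cover : ∀ {x} → x ∈ X → Near m c Divisible (f x) ⊎ Near m c (¬_ ∘ Divisible) (f x)
    cover x∈X with k , eq ← multiple x∈X with lem {P = Divisible k}
    ... | yes d = inj₁ (near m c {k = k} eq d)
    ... | no ¬d = inj₂ (near m c {k = k} eq ¬d)

    divisible⇒~ : ∀ {x} → x ∈ X → Near m c Divisible (f x) → f x ~ c
    divisible⇒~ {x} x∈X near
      with k , eq ← multiple x∈X
      with q , k≡mq ← near-exact m c {k = k} {x = f x} eq near =
      ~⁺ q (*-cancelˡ-≈ (ι-≉0 m≢0) (begin
        ι m * f x
          ≈⟨ solve 3 (λ m c y → m :* y := m :* c :+ (:- (m :* c) :+ y :* m)) refl (ι m) c (f x) ⟩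
        ι m * c + (- (ι m * c) + f x * ι m)        ≈⟨ +-congˡ (trans eq (trans (ι-cong k≡mq) (ι-* m q))) ⟩
        ι m * c + ι m * ι q                        ≈⟨ distribˡ _ _ _ ⟨
        ι m * (c + ι q)                            ∎))

    p-near : Near m c Divisible (f p)
    p-near with q , fp≈c+q ← ~⁻ fp~c = near m c {Divisible} {m ℤ.* q} (begin
      - (ι m * c) + f p * ι m            ≈⟨ +-congˡ (*-congʳ fp≈c+q) ⟩
      - (ι m * c) + (c + ι q) * ι m
        ≈⟨ solve 3 (λ m c q → :- (m :* c) :+ (c :+ q) :* m := m :* q) refl (ι m) c (ι q) ⟩
      ι m * ι q                          ≈⟨ ι-* m q ⟨
      ι (m ℤ.* q)                        ∎) (q , ≡.refl)

    divisible-shift : ∀ {k} l → Divisible k → Divisible (m ℤ.* l ℤ.+ k)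
    divisible-shift l (q , ≡.refl) = l ℤ.+ q , ≡.sym (ℤ.*-distribˡ-+ m l q)

    indivisible-shift : ∀ {k} l → ¬ Divisible k → ¬ Divisible (m ℤ.* l ℤ.+ k)
    indivisible-shift {k} l ¬d (q , eq) = ¬d (q ℤ.- l , ℤ-group.∙-cancelˡ (m ℤ.* l) k _ (≡.trans eq
      (≡.trans (≡.cong (m ℤ.*_) (≡.sym (ℤ-group.xyx⁻¹≈y l q)))
      (≡.trans (≡.cong (m ℤ.*_) (ℤ.+-assoc l q (ℤ.- l))) (ℤ.*-distribˡ-+ m l (q ℤ.- l))))))

    from : Near m c Divisible (f x) ⊎ Near m c (¬_ ∘ Divisible) (f x) → f x ~ c
    from (inj₁ near-c) = divisible⇒~ x∈X near-c
    from (inj₂ far) =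
      let y , y∈X , y-near , y-far = split _ _
            (f-continuous _ (near-open m c {Divisible} divisible-shift))
            (f-continuous _ (near-open m c {¬_ ∘ Divisible} indivisible-shift))
            cover (p , p∈X , p-near) (x , x∈X , far)
          k , eq = multiple y∈X
      in contradiction (near-exact m c {Divisible} {k} {f y} eq y-near)
                       (near-exact m c {¬_ ∘ Divisible} {k} {f y} eq y-far)

-- Homomorphisms, their lifts, and lines in `T`.

module Torus (lem : ∀ {ℓ} → ExcludedMiddle ℓ) (ℝ : Reals)
             {a b : ℕ} (G : ConnectedAbelianLieGroup ℝ a b)
             {ℓ : ℕ} (Γ : FreeAbelianGroup ℓ) where

  open LinearForms lem ℝ
  open Solver using (solve; _:=_; _:+_; _:*_; _:-_; :-_; con)
  open Arrangement ℝ G Γ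
  open Layers lem ℝ T-topology using (Subset; Family; Layer)
  open LayerProperties lem ℝ T-topology using (Meet)
  private
    module G where
      open ConnectedAbelianLieGroup G public
      open Homeomorphism homeomorphism public
        using (to; from; to-cong; from-cong; to-continuous; from-continuous)
        renaming (inverseˡ to to-from; inverseʳ to from-to)
      module to = IsGroupHomomorphism isHomomorphism
    module Γ where
      open FreeAbelianGroup Γ public
      module basis = IsGroupIsomorphism isIso
    module M = AbelianGroup (model ℝ a b)
  open GroupHomomorphism using (⟦_⟧; ⟦⟧-cong; homo; ε-homo; ⁻¹-homo)

  Coordinate : Set
  Coordinate = Fin a ⊎ Fin b

  coordinate : M.Carrier → Coordinate → Carrier
  coordinate p (inj₁ i) = proj₁ p i
  coordinate p (inj₂ j) = proj₂ p j

  point : (Coordinate → Carrier) → M.Carrier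
  point x = x ∘ inj₁ , x ∘ inj₂

  infix 4 _≈[_]_
  _≈[_]_ : Carrier → Coordinate → Carrier → Set
  x ≈[ inj₁ _ ] y = x ~ y
  x ≈[ inj₂ _ ] y = x ≈ y

  ≈⇒≈[] : ∀ j {x y} → x ≈ y → x ≈[ j ] y
  ≈⇒≈[] (inj₁ _) x≈y = ~⁺ 0ℤ (trans x≈y (sym (+-identityʳ _)))
  ≈⇒≈[] (inj₂ _) x≈y = x≈y

  ≈[]⇒~ : ∀ j {x y} → x ≈[ j ] y → x ~ y
  ≈[]⇒~ (inj₁ _) x~y = x~y
  ≈[]⇒~ (inj₂ _) x≈y = ~⁺ 0ℤ (trans x≈y (sym (+-identityʳ _)))

  ≈[]-trans : ∀ j {x y z} → x ≈[ j ] y → y ≈[ j ] z → x ≈[ j ] z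
  ≈[]-trans (inj₁ _) = AbelianGroup.trans (circle ℝ)
  ≈[]-trans (inj₂ _) = trans

  ≈[]-sym : ∀ j {x y} → x ≈[ j ] y → y ≈[ j ] x
  ≈[]-sym (inj₁ _) = AbelianGroup.sym (circle ℝ)
  ≈[]-sym (inj₂ _) = sym

  coordinates-≈ : ∀ {p q} → (∀ j → coordinate p j ≈[ j ] coordinate q j) → p M.≈ q
  coordinates-≈ eq = eq ∘ inj₁ , eq ∘ inj₂

  coordinate-cong : ∀ {p q} → p M.≈ q → ∀ j → coordinate p j ≈[ j ] coordinate q j
  coordinate-cong (eq , _) (inj₁ i) = eq i
  coordinate-cong (_ , eq) (inj₂ j) = eq j

  coords : Γ.Carrier → Fin ℓ → ℤ
  coords γ = proj₁ (Γ.basis.surjective γ)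

  basis-coords : ∀ γ → Γ.basis (coords γ) Γ.≈ γ
  basis-coords γ = proj₂ (Γ.basis.surjective γ) (λ _ → ≡.refl)

  coords-cong : ∀ {γ δ} → γ Γ.≈ δ → coords γ ≗ coords δ
  coords-cong {γ} {δ} γ≈δ = Γ.basis.injective
    (Γ.trans (basis-coords γ) (Γ.trans γ≈δ (Γ.sym (basis-coords δ))))

  coords-∙ : ∀ γ δ → coords (γ Γ.∙ δ) ≗ λ i → coords γ i ℤ.+ coords δ i
  coords-∙ γ δ = Γ.basis.injective (Γ.trans (basis-coords _) (Γ.sym
    (Γ.trans (Γ.basis.∙-homo _ _) (Γ.∙-cong (basis-coords γ) (basis-coords δ)))))

  coords-ε : coords Γ.ε ≗ λ _ → 0ℤ
  coords-ε = Γ.basis.injective (Γ.trans (basis-coords _) (Γ.sym Γ.basis.ε-homo))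

  coords-⁻¹ : ∀ γ → coords (γ Γ.⁻¹) ≗ λ i → ℤ.- coords γ i
  coords-⁻¹ γ = Γ.basis.injective (Γ.trans (basis-coords _) (Γ.sym
    (Γ.trans (Γ.basis.⁻¹-homo _) (Γ.⁻¹-cong (basis-coords γ)))))

  coords-nonzero : ∀ {γ} → ¬ γ Γ.≈ Γ.ε → ∃ λ i → ¬ coords γ i ≡ 0ℤ
  coords-nonzero {γ} γ≉ε with lem {P = ∃ λ i → ¬ coords γ i ≡ 0ℤ}
  ... | yes p = p
  ... | no ∄i = contradiction (Γ.trans (Γ.sym (basis-coords γ))
          (Γ.trans (Γ.basis.⟦⟧-cong all-zero) Γ.basis.ε-homo)) γ≉ε
    where
    all-zero : ∀ i → coords γ i ≡ 0ℤ
    all-zero i with coords γ i ℤ.≟ 0ℤ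
    ... | yes eq = eq
    ... | no ≢0  = contradiction (i , ≢0) ∄i

  -- A homomorphism Γ → ℝ^(a+b), by its values on the basis of Γ.
  Matrix : Set
  Matrix = Coordinate → Fin ℓ → Carrier

  evaluate : Matrix → (Fin ℓ → ℤ) → G.Carrier
  evaluate x v = G.to (point λ j → dot v (x j))

  evaluate-cong : ∀ {v w x y} → (∀ j → dot v (x j) ≈[ j ] dot w (y j)) →
                  evaluate x v G.≈ evaluate y w
  -- `coordinate (point x) j` reduces only for a constructor `j`, hence the split into two identical
  -- cases.
  evaluate-cong {v} {w} {x} {y} eq = G.to-cong (coordinates-≈ {point λ j → dot v (x j)} λ where
    (inj₁ i) → eq (inj₁ i)
    (inj₂ j) → eq (inj₂ j))

  evaluate-+ : ∀ x v w → evaluate x (λ i → v i ℤ.+ w i) G.≈ evaluate x v G.∙ evaluate x w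
  evaluate-+ x v w = G.trans
    (G.to-cong (coordinates-≈ {point λ j → dot (λ i → v i ℤ.+ w i) (x j)} λ where
      (inj₁ i) → ≈⇒≈[] (inj₁ i) (dot-+ v w (x (inj₁ i)))
      (inj₂ j) → dot-+ v w (x (inj₂ j))))
    (G.to.homo (point λ j → dot v (x j)) (point λ j → dot w (x j)))

  evaluate-0 : ∀ x → evaluate x (λ _ → 0ℤ) G.≈ G.ε
  evaluate-0 x = G.trans
    (G.to-cong (coordinates-≈ {point λ j → dot (λ _ → 0ℤ) (x j)} λ where
      (inj₁ i) → ≈⇒≈[] (inj₁ i) (dot-0 (x (inj₁ i)))
      (inj₂ j) → dot-0 (x (inj₂ j))))
    G.to.ε-homo

  evaluate-neg : ∀ x v → evaluate x (λ i → ℤ.- v i) G.≈ evaluate x v G.⁻¹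
  evaluate-neg x v = G.trans
    (G.to-cong (coordinates-≈ {point λ j → dot (λ i → ℤ.- v i) (x j)} λ where
      (inj₁ i) → ≈⇒≈[] (inj₁ i) (dot-neg v (x (inj₁ i)))
      (inj₂ j) → dot-neg v (x (inj₂ j))))
    (G.to.⁻¹-homo (point λ j → dot v (x j)))

  -- The exponential map of `T`: composition with the covering of `G` by its universal cover.
  exp : Matrix → Hom
  exp x = record
    { ⟦_⟧ = λ γ → evaluate x (coords γ)
    ; isGroupHomomorphism = record
      { isMonoidHomomorphism = record
        { isMagmaHomomorphism = record
          { isRelHomomorphism = record
            { cong = λ γ≈δ → evaluate-≗ (coords-cong γ≈δ) }
          ; homo = λ γ δ → G.trans (evaluate-≗ (coords-∙ γ δ)) (evaluate-+ x (coords γ) (coords δ))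
          }
        ; ε-homo = G.trans (evaluate-≗ coords-ε) (evaluate-0 x)
        }
      ; ⁻¹-homo = λ γ → G.trans (evaluate-≗ (coords-⁻¹ γ)) (evaluate-neg x (coords γ))
      }
    }
    where
    evaluate-≗ : ∀ {v w} → v ≗ w → evaluate x v G.≈ evaluate x w
    evaluate-≗ {v} {w} v≗w = evaluate-cong {v} {w} {x} {x} λ j →
      ≈⇒≈[] j (dot-cong {v = v} {w} v≗w (λ _ → refl))

  value : Hom → Γ.Carrier → Coordinate → Carrier
  value φ γ = coordinate (G.from (⟦ φ ⟧ γ))

  Lift : Hom → Matrix → Set
  Lift φ x = ∀ i j → value φ (Γ.basis (unit i)) j ≈[ j ] x j i

  to-from : ∀ g → G.to (G.from g) G.≈ g
  to-from g = G.to-from (M.refl {G.from g})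

  from-to : ∀ p → G.from (G.to p) M.≈ p
  from-to p = G.from-to {x = p} {y = G.to p} G.refl

  -- Both sides are homomorphisms, and they agree on the basis of `Γ`.
  lift⇒≈exp : ∀ {φ x} → Lift φ x → ∀ γ → ⟦ φ ⟧ γ G.≈ ⟦ exp x ⟧ γ
  lift⇒≈exp {φ} {x} φ-x γ = G.trans (⟦⟧-cong φ (Γ.sym (basis-coords γ)))
    (ℤ^-induction (λ v → ⟦ φ ⟧ (Γ.basis v) G.≈ evaluate x v)
      (λ {v} {w} v≗w eq → G.trans (⟦⟧-cong φ (Γ.basis.⟦⟧-cong (≡.sym ∘ v≗w))) (G.trans eq
        (evaluate-cong {v} {w} {x} {x} λ j → ≈⇒≈[] j (dot-cong {v = v} {w} v≗w (λ _ → refl)))))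
      (G.trans (⟦⟧-cong φ Γ.basis.ε-homo) (G.trans (ε-homo φ) (G.sym (evaluate-0 x))))
      (λ {v} {w} eq eq′ → G.trans (⟦⟧-cong φ (Γ.basis.∙-homo v w)) (G.trans (homo φ _ _)
        (G.trans (G.∙-cong eq eq′) (G.sym (evaluate-+ x v w)))))
      (λ {v} eq → G.trans (⟦⟧-cong φ (Γ.basis.⁻¹-homo v)) (G.trans (⁻¹-homo φ _)
        (G.trans (G.⁻¹-cong eq) (G.sym (evaluate-neg x v)))))
      (λ i → G.trans (G.sym (to-from _)) (G.to-cong (coordinates-≈ {G.from (⟦ φ ⟧ (Γ.basis (unit i)))} λ where
        (inj₁ k) → ≈[]-trans (inj₁ k) (φ-x i (inj₁ k)) (≈⇒≈[] (inj₁ k) (sym (dot-unit i (x (inj₁ k)))))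
        (inj₂ k) → trans (φ-x i (inj₂ k)) (sym (dot-unit i (x (inj₂ k)))))))
      (coords γ))

  value-exp : ∀ x γ j → value (exp x) γ j ≈[ j ] dot (coords γ) (x j)
  value-exp x γ (inj₁ i) = proj₁ (from-to (point λ j → dot (coords γ) (x j))) i
  value-exp x γ (inj₂ i) = proj₂ (from-to (point λ j → dot (coords γ) (x j))) i

  value-lift : ∀ {φ x} → Lift φ x → ∀ γ j → value φ γ j ≈[ j ] dot (coords γ) (x j)
  value-lift {φ} {x} φ-x γ j = ≈[]-trans j
    (coordinate-cong (G.from-cong (lift⇒≈exp {φ} {x} φ-x γ)) j) (value-exp x γ j)

  -- Elements of the circle are represented by real numbers, so the values on the basis already are
  -- a lift.
  some-lift : ∀ φ → Lift φ (λ j i → value φ (Γ.basis (unit i)) j)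
  some-lift φ i j = ≈⇒≈[] j refl

  hypersurface⁺ : ∀ {p φ} → (∀ j → value φ (proj₁ (proj₁ p)) j ≈[ j ] coordinate (G.from (proj₂ p)) j) →
                  φ ∈ hypersurface p
  hypersurface⁺ {(α , _) , c} {φ} eq = G.trans (G.sym (to-from _))
    (G.trans (G.to-cong (coordinates-≈ {G.from (⟦ φ ⟧ α)} {G.from c} eq)) (to-from c))

  hypersurface⁻ : ∀ {p φ} → φ ∈ hypersurface p →
                  ∀ j → value φ (proj₁ (proj₁ p)) j ≈[ j ] coordinate (G.from (proj₂ p)) j
  hypersurface⁻ φ∈ = coordinate-cong (G.from-cong φ∈)

  along : Matrix → Matrix → Carrier → Matrix
  along x d s j i = x j i + s * d j i

  -- Membership is up to equality in `T`, so that any homomorphism with a lift on the line belongs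
  -- to it.
  Line : Matrix → Matrix → Subset
  Line x d φ = ∃ λ s → ∀ γ → ⟦ exp (along x d s) ⟧ γ G.≈ ⟦ φ ⟧ γ

  dot-along : ∀ v x d s j → dot v (along x d s j) ≈ dot v (x j) + s * dot v (d j)
  dot-along v x d s j = dot-affine v (x j) (d j) s

  value-along : ∀ x d s γ j →
    value (exp (along x d s)) γ j ≈[ j ] dot (coords γ) (x j) + s * dot (coords γ) (d j)
  value-along x d s γ j = ≈[]-trans j (value-exp (along x d s) γ j)
    (≈⇒≈[] j (dot-along (coords γ) x d s j))

  dot-along-continuous : ∀ v x d j → Continuous τℝ τℝ (λ s → dot v (along x d s j))
  dot-along-continuous v x d j V V-open@(resp , _) = Topology.Open-resp-≐ τℝ
    ((λ {s} → resp (affine s)) , λ {s} → resp (sym (affine s)))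
    (affine-continuous (dot v (x j)) (dot v (d j)) V V-open)
    where
    affine : ∀ s → dot v (x j) + s * dot v (d j) ≈ dot v (along x d s j)
    affine s = sym (dot-along v x d s j)

  -- Both topologies involved are initial, so it suffices to test the coordinates of the value at
  -- each `γ`, and these are affine in `s`.
  line-continuous : ∀ x d → Continuous τℝ T-topology (λ s → exp (along x d s))
  line-continuous x d = initial-universal _ _ τℝ _ λ γ W W-open →
    initial-universal _ _ τℝ (λ s → point λ j → dot (coords γ) (along x d s j))
      (λ { (inj₁ i) V V-open → dot-along-continuous (coords γ) x d (inj₁ i) V (proj₂ V-open)
         ; (inj₂ j) → dot-along-continuous (coords γ) x d (inj₂ j) })
      _ (G.to-continuous W W-open)

  value-continuous : ∀ γ i → Continuous T-topology τS¹ (λ φ → value φ γ (inj₁ i))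
  value-continuous γ i V V-open = initial-projection _ _ γ (λ g → V (proj₁ (G.from g) i))
    (G.from-continuous (λ p → V (proj₁ p i)) (initial-projection _ _ (inj₁ i) V V-open))

  line-connected : ∀ x d → Connected T-topology (Line x d)
  line-connected x d = (exp (along x d 0#) , 0# , λ _ → G.refl) ,
    λ V W V-open W-open cover (_ , (s , s≈v) , v∈V) (_ , (t , t≈w) , w∈W) →
      let r , _ , r∈VW = proj₂ ℝ-connected _ _
            (line-continuous x d V V-open) (line-continuous x d W W-open)
            (λ {u} _ → cover (u , λ _ → G.refl))
            (s , tt , Topology.Open-resp-≈ T-topology V-open (λ γ → G.sym (s≈v γ)) v∈V)
            (t , tt , Topology.Open-resp-≈ T-topology W-open (λ γ → G.sym (t≈w γ)) w∈W)
      in exp (along x d r) , (r , λ _ → G.refl) , r∈VW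

  difference : Matrix → Matrix → Matrix
  difference x y j i = y j i - x j i

  line-start : ∀ {φ x} → Lift φ x → ∀ d → φ ∈ Line x d
  line-start {φ} {x} φ-x d = 0# , λ γ → G.trans
    (evaluate-cong {coords γ} {coords γ} {along x d 0#} {x} λ j → ≈⇒≈[] j
      (trans (dot-along (coords γ) x d 0# j) (trans (+-congˡ (zeroˡ _)) (+-identityʳ _))))
    (G.sym (lift⇒≈exp {φ} φ-x γ))

  line-end : ∀ {φ x y} → Lift φ y → φ ∈ Line x (difference x y)
  line-end {φ} {x} {y} φ-y = 1# , λ γ → G.trans
    (evaluate-cong {coords γ} {coords γ} {along x (difference x y) 1#} {y} λ j → ≈⇒≈[] j
      (dot-cong {v = coords γ} (λ _ → ≡.refl) λ i →
        trans (+-congˡ (*-identityˡ _)) (solve 2 (λ x y → x :+ (y :- x) := y) refl (x j i) (y j i))))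
    (G.sym (lift⇒≈exp {φ} φ-y γ))

  T-connected : Connected T-topology U
  T-connected = (exp (λ _ _ → 0#) , tt) ,
    λ V W V-open W-open cover (φ , _ , φ∈V) (ψ , _ , ψ∈W) →
      let x = λ j i → value φ (Γ.basis (unit i)) j
          y = λ j i → value ψ (Γ.basis (unit i)) j
          χ , _ , χ∈VW = proj₂ (line-connected x (difference x y)) V W V-open W-open
            (λ {χ} _ → cover {χ} tt)
            (φ , line-start {φ} (some-lift φ) (difference x y) , φ∈V)
            (ψ , line-end {ψ} {x} (some-lift ψ) , ψ∈W)
      in χ , tt , χ∈VW

  -- Evaluation at `α` lifts to the linear form `coords α`, which is constant along directions that
  -- it annihilates.
  line⊆hypersurface : ∀ {p φ x d} → Lift φ x → φ ∈ hypersurface p →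
    (∀ j → dot (coords (proj₁ (proj₁ p))) (d j) ≈ 0#) → Line x d ⊆ hypersurface p
  line⊆hypersurface {(α , _) , c} {φ} {x} {d} φ-x φ∈ d≈0 {ψ} (s , s≈ψ) =
    G.trans (G.sym (s≈ψ α)) (G.trans
      (evaluate-cong {coords α} {coords α} {along x d s} {x} λ j → ≈⇒≈[] j
        (trans (dot-along (coords α) x d s j)
        (trans (+-congˡ (trans (*-congˡ (d≈0 j)) (zeroʳ s))) (+-identityʳ _))))
      (G.trans (G.sym (lift⇒≈exp {φ} φ-x α)) φ∈))

  -- Along the line the lifted value at `α` is affine in the parameter, yet constant modulo
  -- integers, so its slope is zero.
  line-direction : ∀ {p x d} → Line x d ⊆ hypersurface p →
                   ∀ j → dot (coords (proj₁ (proj₁ p))) (d j) ≈ 0#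
  line-direction {p@((α , _) , c)} {x} {d} line⊆ j = integral-line⇒constant λ s →
    ≈[]⇒~ j (≈[]-trans j (≈[]-sym j (value-along x d s α j))
      (hypersurface⁻ {p} {exp (along x d s)} (line⊆ {exp (along x d s)} (s , λ _ → G.refl)) j))

  ≈[]-scale : ∀ k j {x y} → x ≈[ j ] y → ι k * x ≈[ j ] ι k * y
  ≈[]-scale k (inj₁ _) = ~-scale k
  ≈[]-scale k (inj₂ _) = *-congˡ

  -- A line in a basis direction on which `α` does not vanish leaves the hypersurface. The
  -- coordinate witnesses that `G` is not trivial; over the trivial group every hypersurface is all
  -- of `T`.
  U⊈hypersurface : Coordinate → ∀ p → ¬ U ⊆ hypersurface p
  U⊈hypersurface j p@((α , α≉0) , c) U⊆ = αᵢ≉0 (trans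
    (sym (trans (dot-comm (coords α) (unit i)) (dot-unit i (ι ∘ coords α))))
    (line-direction {p} {λ _ _ → 0#} {λ _ → ι ∘ unit i} (λ {χ} _ → U⊆ {χ} tt) j))
    where
    i = proj₁ (coords-nonzero α≉0)
    αᵢ≉0 = ι-≉0 (proj₂ (coords-nonzero α≉0))

  -- Incomparability of components of hypersurfaces.

  module _ (j₀ : Coordinate) {p q : NonZeroCharacter × G.Carrier} {H K : Subset}
    (H-component : _IsComponentOf_ T-topology H (hypersurface p))
    (K-component : _IsComponentOf_ T-topology K (hypersurface q)) (H⊆K : H ⊆ K) where

    private
      α β : Γ.Carrier
      α = proj₁ (proj₁ p)
      β = proj₁ (proj₁ q)
      A B : Fin ℓ → ℤ
      A = coords α
      B = coords β
      c e : Coordinate → Carrier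
      c = coordinate (G.from (proj₂ p))
      e = coordinate (G.from (proj₂ q))

      φ : Hom
      φ = proj₁ (proj₁ (proj₁ H-component))
      φ∈H : φ ∈ H
      φ∈H = proj₂ (proj₁ (proj₁ H-component))
      H⊆p : H ⊆ hypersurface p
      H⊆p = proj₁ (proj₂ H-component)
      K⊆q : K ⊆ hypersurface q
      K⊆q = proj₁ (proj₂ K-component)

      i₀ : Fin ℓ
      i₀ = proj₁ (coords-nonzero (proj₂ (proj₁ p)))
      m n : ℤ
      m = B i₀
      n = A i₀

      -- A vanishes at w i, hence so does B, which makes B proportional to A.
      w : Fin ℓ → Fin ℓ → ℤ
      w i k = n ℤ.* unit i k ℤ.+ (ℤ.- A i) ℤ.* unit i₀ k

      dot-w : ∀ v i → dot v (ι ∘ w i) ≈ ι (n ℤ.* v i ℤ.+ (ℤ.- A i) ℤ.* v i₀)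
      dot-w v i = begin
        dot v (ι ∘ w i)          ≈⟨ dot-comm v (w i) ⟩
        dot (w i) (ι ∘ v)        ≈⟨ dot-+ (λ k → n ℤ.* unit i k) (λ k → (ℤ.- A i) ℤ.* unit i₀ k) (ι ∘ v) ⟩
        dot (λ k → n ℤ.* unit i k) (ι ∘ v) + dot (λ k → (ℤ.- A i) ℤ.* unit i₀ k) (ι ∘ v)
          ≈⟨ +-cong (multiple n i) (multiple (ℤ.- A i) i₀) ⟩
        ι (n ℤ.* v i) + ι ((ℤ.- A i) ℤ.* v i₀)   ≈⟨ ι-+ (n ℤ.* v i) ((ℤ.- A i) ℤ.* v i₀) ⟨
        ι (n ℤ.* v i ℤ.+ (ℤ.- A i) ℤ.* v i₀) ∎
        where
        open ≈-Reasoning setoid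
        multiple : ∀ k i → dot (λ j → k ℤ.* unit i j) (ι ∘ v) ≈ ι (k ℤ.* v i)
        multiple k i = trans (dot-scale k (unit i) (ι ∘ v))
          (trans (*-congˡ (dot-unit i (ι ∘ v))) (sym (ι-* k (v i))))

      swap-factors : ∀ x y z t → x ℤ.* y ℤ.+ (ℤ.- z) ℤ.* t ≡ 0ℤ → x ℤ.* y ≡ z ℤ.* t
      swap-factors x y z t eq = ℤ-group.x∙y⁻¹≈ε⇒x≈y (x ℤ.* y) (z ℤ.* t)
        (≡.trans (≡.cong (ℤ._+_ (x ℤ.* y)) (ℤ.neg-distribˡ-* z t)) eq)

      w-kills-A : ∀ i → dot A (ι ∘ w i) ≈ 0#
      w-kills-A i = trans (dot-w A i) (ι-cong (≡.trans
        (≡.cong₂ ℤ._+_ (ℤ.*-comm n (A i)) (≡.sym (ℤ.neg-distribˡ-* (A i) n)))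
        (ℤ.+-inverseʳ (A i ℤ.* n))))

      -- The line through `φ` in direction `w i` stays in the hypersurface of `p`, so in its
      -- component `H`, hence in `K` and in the hypersurface of `q`. Therefore `B` annihilates
      -- `w i`, which is the asserted equation.
      proportional : ∀ i → m ℤ.* A i ≡ n ℤ.* B i
      proportional i = ≡.trans (ℤ.*-comm m (A i)) (≡.sym (swap-factors n (B i) (A i) m
        (ι-injective (trans (sym (dot-w B i)) (line-direction {q} {x} {d} (λ {χ} → line⊆q {χ}) j₀)))))
        where
        x d : Matrix
        x j k = value φ (Γ.basis (unit k)) j
        d _ = ι ∘ w i
        line⊆q : Line x d ⊆ hypersurface q
        line⊆q {χ} χ∈ = K⊆q {χ} (H⊆K (component-absorbs T-topology H-component (line-connected x d)
          (λ {χ} → line⊆hypersurface {p} {φ} {x} {d} (some-lift φ) (H⊆p φ∈H) (λ _ → w-kills-A i) {χ})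
          (φ , φ∈H , line-start {φ} (some-lift φ) d) χ∈))

      -- Otherwise `n B` would vanish, although neither `n` nor `B` does.
      m≢0 : ¬ m ≡ 0ℤ
      m≢0 m≡0 = cases (ℤ.i*j≡0⇒i≡0∨j≡0 n
        (≡.trans (≡.sym (proportional i₁)) (≡.trans (≡.cong (ℤ._* A i₁) m≡0) (ℤ.*-zeroˡ (A i₁)))))
        where
        i₁ : Fin ℓ
        i₁ = proj₁ (coords-nonzero (proj₂ (proj₁ q)))
        cases : ¬ (n ≡ 0ℤ ⊎ B i₁ ≡ 0ℤ)
        cases (inj₁ n≡0)   = proj₂ (coords-nonzero (proj₂ (proj₁ p))) n≡0
        cases (inj₂ Bi₁≡0) = proj₂ (coords-nonzero (proj₂ (proj₁ q))) Bi₁≡0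

      -- By proportionality `m` times the value at `α` is `n` times the value at `β`, which is
      -- prescribed on `K`.
      multiple-determined : ∀ {χ} → χ ∈ K → ∀ j → ι m * value χ α j ≈[ j ] ι n * e j
      multiple-determined {χ} χ∈K j = ≈[]-trans j (≈[]-scale m j (value-lift {χ} χ-z α j))
        (≈[]-trans j (≈⇒≈[] j scale)
        (≈[]-scale n j (≈[]-trans j (≈[]-sym j (value-lift {χ} χ-z β j)) (hypersurface⁻ {q} {χ} (K⊆q χ∈K) j))))
        where
        z : Matrix
        z j k = value χ (Γ.basis (unit k)) j
        χ-z : Lift χ z
        χ-z = some-lift χ
        scale : ι m * dot A (z j) ≈ ι n * dot B (z j)
        scale = trans (sym (dot-scale m A (z j)))
          (trans (dot-cong proportional (λ _ → refl)) (dot-scale n B (z j)))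

      -- The determined multiple is the same at `φ`, where the value at `α` is `c`.
      torsion : ∀ {χ} → χ ∈ K → ∀ j → ι m * value χ α j ≈[ j ] ι m * c j
      torsion {χ} χ∈K j = ≈[]-trans j (multiple-determined {χ} χ∈K j)
        (≈[]-trans j (≈[]-sym j (multiple-determined {φ} (H⊆K φ∈H) j))
                     (≈[]-scale m j (hypersurface⁻ {p} {φ} (H⊆p φ∈H) j)))

      K⊆p : K ⊆ hypersurface p
      K⊆p {χ} χ∈K = hypersurface⁺ {p} {χ} λ where
        (inj₁ i) → torsion-locally-constant T-topology (λ χ → value χ α (inj₁ i))
          (value-continuous α i) (proj₁ K-component) m (c (inj₁ i)) m≢0
          (λ {χ} χ∈K → torsion {χ} χ∈K (inj₁ i))
          (H⊆K φ∈H) (hypersurface⁻ {p} {φ} (H⊆p φ∈H) (inj₁ i)) χ∈K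
        -- The line has no torsion, so `m` can simply be cancelled.
        (inj₂ i) → *-cancelˡ-≈ (ι-≉0 m≢0) (torsion {χ} χ∈K (inj₂ i))

    components-incomparable : K ⊆ H
    components-incomparable = component-absorbs T-topology H-component (proj₁ K-component)
      K⊆p (φ , φ∈H , H⊆K φ∈H)

  -- Finitely many types of homomorphisms.

  module Type (𝒜 : List (NonZeroCharacter × G.Carrier)) where

    private
      bound : List (NonZeroCharacter × G.Carrier) → ℕ
      bound []       = 0
      bound (p ∷ ps) = norm (coords (proj₁ (proj₁ p))) ℕ.+ bound ps

      norm≤bound : ∀ ps k → norm (coords (proj₁ (proj₁ (lookup ps k)))) ℕ.≤ bound ps
      norm≤bound (p ∷ ps) zero    = ℕ.m≤m+n _ (bound ps)
      norm≤bound (p ∷ ps) (suc k) =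
        ℕ.≤-trans (norm≤bound ps k) (ℕ.m≤n+m _ (norm (coords (proj₁ (proj₁ p)))))

      -- It exceeds the norm of every character in the list, so that on differences of at most
      -- `1 / N` per coordinate each of these forms stays below 1 in absolute value.
      N : ℕ
      N = suc (bound 𝒜)

      residues : ∀ φ (i : Fin ℓ) (k : Fin a) → _
      residues φ i k = residue N (value φ (Γ.basis (unit i)) (inj₁ k))

      -- The lift whose circle coordinates lie in the half-open unit interval, where sharing a
      -- residue means being within `1 / N`.
      reduced : Hom → Matrix
      reduced φ (inj₁ k) i = proj₁ (proj₂ (residues φ i k))
      reduced φ (inj₂ k) i = value φ (Γ.basis (unit i)) (inj₂ k)

      reduced-lift : ∀ φ → Lift φ (reduced φ)
      reduced-lift φ i (inj₁ k) = ≈[]-sym (inj₁ k) (proj₁ (proj₂ (proj₂ (residues φ i k))))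
      reduced-lift φ i (inj₂ k) = refl

      residue-type : Hom → Fin ℓ → Fin a → Fin N
      residue-type φ i k = proj₁ (residues φ i k)

      incidence : Hom → Fin (length 𝒜) → Fin 2
      incidence φ k = bit (lem {P = φ ∈ hypersurface (lookup 𝒜 k)})

      residue-code : Hom → Fin ((N ℕ.^ a) ℕ.^ ℓ)
      residue-code φ = funToFin λ i → funToFin (residue-type φ i)

      incidence-code : Hom → Fin (2 ℕ.^ length 𝒜)
      incidence-code φ = funToFin (incidence φ)

    -- In a line coordinate, lying on the same hypersurface makes the values at its character equal
    -- outright and not only modulo integers; so only circle coordinates are subdivided.
    type : Hom → Fin ((N ℕ.^ a) ℕ.^ ℓ ℕ.* 2 ℕ.^ length 𝒜)
    type φ = combine (residue-code φ) (incidence-code φ)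

    module _ {φ ψ : Hom} (same : type φ ≡ type ψ) where

      private
        same-codes : residue-code φ ≡ residue-code ψ × incidence-code φ ≡ incidence-code ψ
        same-codes = Fin.combine-injective
          (residue-code φ) (incidence-code φ) (residue-code ψ) (incidence-code ψ) same

        same-residues : ∀ i k → residue-type φ i k ≡ residue-type ψ i k
        same-residues i = funToFin-injective
          (funToFin-injective {f = λ i → funToFin (residue-type φ i)} (proj₁ same-codes) i)

        same-incidence : ∀ k → φ ∈ hypersurface (lookup 𝒜 k) → ψ ∈ hypersurface (lookup 𝒜 k)
        same-incidence k = bit-injective (lem {P = φ ∈ hypersurface (lookup 𝒜 k)}) lem
          (funToFin-injective {f = incidence φ} (proj₂ same-codes) k)

        x y : Matrix
        x = reduced φ
        y = reduced ψ

        close : ∀ i k → Bounded 1 (ι (+ N) * (y (inj₁ k) i - x (inj₁ k) i))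
        close i k = bounded-resp {1} (solve 3 (λ N x y → N :* y :- N :* x := N :* (y :- x)) refl (ι (+ N)) _ _)
          (same-residue {r = + toℕ (residue-type ψ i k)}
            (proj₁ ψ-bounds) (proj₂ ψ-bounds)
            (≤-respˡ-≈ r≈ (proj₁ φ-bounds)) (<-respʳ-≈ (+-congʳ r≈) (proj₂ φ-bounds)))
          where
          φ-bounds = proj₂ (proj₂ (proj₂ (residues φ i k)))
          ψ-bounds = proj₂ (proj₂ (proj₂ (residues ψ i k)))
          r≈ : ι (+ toℕ (residue-type φ i k)) ≈ ι (+ toℕ (residue-type ψ i k))
          r≈ = ι-cong (≡.cong (λ r → + toℕ r) (same-residues i k))

        -- In a circle coordinate the form takes an integer value `z` on the difference, and
        -- closeness bounds `N z` by a norm below `N`, so `z` is zero.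
        parallel : ∀ k → φ ∈ hypersurface (lookup 𝒜 k) →
          ∀ j → dot (coords (proj₁ (proj₁ (lookup 𝒜 k)))) (difference x y j) ≈ 0#
        parallel k φ∈ = zero-difference
          where
          p = lookup 𝒜 k
          α = proj₁ (proj₁ p)
          A = coords α

          agree : ∀ j → dot A (y j) ≈[ j ] dot A (x j)
          agree j = ≈[]-trans j (≈[]-sym j (value-lift {ψ} (reduced-lift ψ) α j))
            (≈[]-trans j (hypersurface⁻ {p} {ψ} (same-incidence k φ∈) j)
            (≈[]-trans j (≈[]-sym j (hypersurface⁻ {p} {φ} φ∈ j)) (value-lift {φ} (reduced-lift φ) α j)))

          zero-difference : ∀ j → dot A (difference x y j) ≈ 0#
          zero-difference (inj₂ i) = trans (dot-difference A (y (inj₂ i)) (x (inj₂ i)))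
            (trans (+-congʳ (agree (inj₂ i))) (-‿inverseʳ _))
          zero-difference (inj₁ i) = trans integral (ι-cong (bounded-integer {norm A} {N} z
            (ℕ.s≤s (norm≤bound 𝒜 k))
            (bounded-resp {norm A} (trans (dot-multiple A (difference x y (inj₁ i)) (ι (+ N))) (*-congˡ integral))
              (bounded-dot A (λ l → close l i)))))
            where
            z = proj₁ (~⁻ (agree (inj₁ i)))
            integral : dot A (difference x y (inj₁ i)) ≈ ι z
            integral = trans (dot-difference A (y (inj₁ i)) (x (inj₁ i)))
              (trans (+-congʳ (proj₂ (~⁻ (agree (inj₁ i)))))
                (solve 2 (λ a z → (a :+ z) :- a := z) refl (dot A (x (inj₁ i))) (ι z)))

      -- The line from `φ` to `ψ` lies in every hypersurface through `φ`. It meets each member of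
      -- `B` in `φ`, so each of them absorbs it, and then so does the component `X` of their
      -- intersection.
      type-saturated : ∀ {X} → X ∈ Layer U (arrangement 𝒜) → φ ∈ X → ψ ∈ X
      type-saturated {X} (B , B⊆ , X-component) φ∈X =
        component-absorbs T-topology X-component (line-connected x (difference x y)) line⊆
          (φ , φ∈X , φ∈line) (line-end {ψ} {x} (reduced-lift ψ))
        where
        φ∈line : φ ∈ Line x (difference x y)
        φ∈line = line-start {φ} (reduced-lift φ) (difference x y)

        line⊆K : ∀ {K} → K ∈ B → Line x (difference x y) ⊆ K
        line⊆K {K} K∈B = component-absorbs T-topology K-component (line-connected x (difference x y))
          (λ {χ} → line⊆hypersurface {lookup 𝒜 k} {φ} {x} (reduced-lift φ) φ∈k (parallel k φ∈k) {χ})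
          (φ , φ∈K , φ∈line)
          where
          k = Any.index (B⊆ K∈B)
          K-component : _IsComponentOf_ T-topology K (hypersurface (lookup 𝒜 k))
          K-component = lookup-index (B⊆ K∈B)
          φ∈K : φ ∈ K
          φ∈K = proj₂ (proj₁ (proj₂ X-component) φ∈X) K K∈B
          φ∈k : φ ∈ hypersurface (lookup 𝒜 k)
          φ∈k = proj₁ (proj₂ K-component) φ∈K

        line⊆ : Line x (difference x y) ⊆ Meet U B
        line⊆ χ∈ = tt , λ K K∈B → line⊆K K∈B χ∈

open import Data.Nat.Base using (_+_; _<_)

theorem5p8 : (lem : ∀ {ℓ} → ExcludedMiddle ℓ) (ℝ : Reals)
    (a b : ℕ) → 0 < a + b → (G : ConnectedAbelianLieGroup ℝ a b)
    (ℓ : ℕ) (Γ : FreeAbelianGroup ℓ) →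
    let open Arrangement ℝ G Γ
        open Layers lem ℝ T-topology
    in (𝒜 : List (NonZeroCharacter × ConnectedAbelianLieGroup.Carrier G))
       (H : Subset) → H ∈ arrangement 𝒜 →
       χ U (arrangement 𝒜)
         ≈ₚ χ U (deletion (arrangement 𝒜) H)
            -ₚ χ H (restriction (arrangement 𝒜) H)
theorem5p8 lem ℝ a b 0<a+b G ℓ Γ 𝒜 H H∈ =
  χ-deletion-restriction type (λ X∈ same → type-saturated same X∈)
  where
  open Torus lem ℝ G Γ
  open Arrangement ℝ G Γ
  open Type 𝒜

  -- Properness and incomparability both compare directions of lines, which takes at least one
  -- coordinate of `G`.
  j₀ : Coordinate
  j₀ = some-coordinate {a} {b} 0<a+b
    where
    some-coordinate : ∀ {a b} → 0 < a + b → Fin a ⊎ Fin b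
    some-coordinate {suc a}         _ = inj₁ zero
    some-coordinate {zero}  {suc b} _ = inj₂ zero

  hypersurface-of : ∀ {K} → K ∈ arrangement 𝒜 → ∃ λ p → _IsComponentOf_ T-topology K (hypersurface p)
  hypersurface-of K∈ = lookup 𝒜 (Any.index K∈) , lookup-index K∈

  open LayerProperties.DeletionRestriction lem ℝ T-topology H∈ T-connected
    (proj₁ (proj₂ (hypersurface-of H∈)))
    (λ K∈ U⊆K → U⊈hypersurface j₀ (proj₁ (hypersurface-of K∈))
      (λ {χ} x∈ → proj₁ (proj₂ (proj₂ (hypersurface-of K∈))) {χ} (U⊆K x∈)))
    (λ K∈ H⊆K {χ} → components-incomparable j₀ {proj₁ (hypersurface-of H∈)} {proj₁ (hypersurface-of K∈)}
      (proj₂ (hypersurface-of H∈)) (proj₂ (hypersurface-of K∈)) H⊆K {χ})
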